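{- Let $n$ be a positive integer. Then each of $$\frac{1-q}{1-q^{6n-1}}\begin{bmatrix}12n\\3n\end{bmatrix}_q,\ \frac{1-q}{1-q^{6n-1}}\begin{bmatrix}12n\\4n\end{bmatrix}_q,\ \frac{1-q}{1-q^{30n-1}}\begin{bmatrix}60n\\6n\end{bmatrix}_q,\ \frac{1-q}{1-q^{30n-1}}\begin{bmatrix}120n\\40n\end{bmatrix}_q,\ \frac{1-q}{1-q^{30n-1}}\begin{bmatrix}120n\\45n\end{bmatrix}_q,\ \frac{1-q}{1-q^{66n-1}}\begin{bmatrix}330n\\88n\end{bmatrix}_q$$ is a polynomial in $q$ with non-negative integer coefficients. Furthermore, $$\frac{(1-q)^2}{(1-q^{10n-1})(1-q^{15n-1})}\begin{bmatrix}30n\\5n\end{bmatrix}_q$$ is a polynomial in $q$.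
   Context: The $q$-binomial coefficient is defined by $\begin{bmatrix}n\\k\end{bmatrix}_q=\frac{(1-q^n)(1-q^{n-1})\cdots(1-q)}{(1-q^k)\cdots(1-q)\,(1-q^{n-k})\cdots(1-q)}$ for $0\le k\le n$, and $0$ otherwise. -}

module Defs where

open import Data.Nat using (ℕ; zero; suc; _∸_)
open import Data.Integer using (ℤ; 0ℤ; 1ℤ; -1ℤ; +_) renaming (_+_ to _+ℤ_; _*_ to _*ℤ_)
open import Data.List using (List; []; _∷_; map; replicate; _++_)
open import Data.Product using (Σ)
open import Relation.Binary.PropositionalEquality using (_≡_)

-- Polynomials in q with integer coefficients, as coefficient lists
-- (lowest degree first).  Trailing zeros are allowed; polynomial
-- equality is coefficientwise (see _≈P_).
Poly : Set
Poly = List ℤ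

coeff : Poly → ℕ → ℤ
coeff []       _       = 0ℤ
coeff (a ∷ p)  zero    = a
coeff (a ∷ p)  (suc i) = coeff p i

infix 4 _≈P_
_≈P_ : Poly → Poly → Set
p ≈P r = ∀ i → coeff p i ≡ coeff r i

infixl 6 _+P_
_+P_ : Poly → Poly → Poly
[]      +P r       = r
(a ∷ p) +P []      = a ∷ p
(a ∷ p) +P (b ∷ r) = (a +ℤ b) ∷ (p +P r)

scale : ℤ → Poly → Poly
scale c = map (c *ℤ_)

infixl 7 _*P_
_*P_ : Poly → Poly → Poly
[]      *P r = []
(a ∷ p) *P r = scale a r +P (0ℤ ∷ (p *P r))

oneMinusQ^ : ℕ → Poly
oneMinusQ^ m = (1ℤ ∷ []) +P (replicate m 0ℤ ++ (-1ℤ ∷ []))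

qPoch : ℕ → Poly
qPoch zero    = 1ℤ ∷ []
qPoch (suc N) = qPoch N *P oneMinusQ^ (suc N)

-- Numerator and denominator of the q-binomial coefficient [N choose K]_q,
-- exactly as in its defining formula (used only with K ≤ N):
--   [N choose K]_q = (q;q)_N / ((q;q)_K (q;q)_{N-K}).
qBinomNum : ℕ → ℕ → Poly
qBinomNum N K = qPoch N

qBinomDen : ℕ → ℕ → Poly
qBinomDen N K = qPoch K *P qPoch (N ∸ K)

ℕPoly→Poly : List ℕ → Poly
ℕPoly→Poly = map +_

-- "(1-q)/(1-q^m) * [N choose K]_q is a polynomial in q with non-negative
-- integer coefficients": there is P with nonneg integer coefficients such that
--   P = (1-q) (q;q)_N / ((1-q^m) (q;q)_K (q;q)_{N-K})
-- i.e. (cross-multiplied, all denominators being nonzero polynomials)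
--   P (1-q^m) (q;q)_K (q;q)_{N-K} = (1-q) (q;q)_N.
NonNegPolyQuot : (m N K : ℕ) → Set
NonNegPolyQuot m N K =
  Σ (List ℕ) λ P →
    ℕPoly→Poly P *P oneMinusQ^ m *P qBinomDen N K
      ≈P oneMinusQ^ 1 *P qBinomNum N K

PolyQuot2 : (a b N K : ℕ) → Set
PolyQuot2 a b N K =
  Σ Poly λ P →
    P *P oneMinusQ^ a *P oneMinusQ^ b *P qBinomDen N K
      ≈P oneMinusQ^ 1 *P oneMinusQ^ 1 *P qBinomNum N K

{-# OPTIONS --safe #-}

-- Write [N,K] for the q-binomial coefficient and m = M n - 1.
--
-- Polynomiality.  Since (1-q^k)[k+l,k] = (1-q^(k+l))[k+l-1,k-1], one descends from [N-e-1,K-e-1] to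
-- [N,K], where N = e (m+1), so that 1-q^m divides 1-q^(N-e).  At each step the factor 1-q^(K-j) is
-- (1-q^g) w with g = gcd(K-j,m), and w is invertible modulo 1-q^m over ℚ by the Bézout identity for
-- the polynomials 1-q^a.  Almost always g = 1; a single exceptional g dividing e is compensated by
-- 1-q^N.  Denominators are removed at the end: if c divides all coefficients of (1-q^m) p, it
-- divides all those of p.
--
-- Non-negativity.  [N,K] is symmetric and unimodal (Sylvester), so the coefficients of (1-q)[N,K]
-- are ≥ 0 up to the middle and ≤ 0 beyond it.  Solving for the coefficients of the quotient upwards
-- from degree 0 in the lower half, and downwards from large degrees in the upper half, gives ≥ 0.
-- Unimodality comes from the action of sl₂ on the K-th exterior power of its N-dimensional
-- irreducible representation, whose basis vectors are the binary words with K letters "true": the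
-- raising operator is injective below the middle degree.
module Submission where

open import Defs
open import Algebra.Bundles using (AbelianGroup; CommutativeRing)
open import Data.Bool using (Bool; true; false; if_then_else_)
import Data.Bool.Properties as Bool
open import Data.Fin using (Fin; zero; suc; punchIn)
open import Data.Fin.Properties using (any?)
open import Data.Integer as ℤ using (ℤ; 0ℤ; 1ℤ; +_)
import Data.Integer.Properties as ℤ
import Data.Integer.Tactic.RingSolver as ℤ-Solver
open import Data.List using (List; []; _∷_; _++_; _∷ʳ_; length; lookup; map; replicate; reverse)
open import Data.List.Membership.Propositional using (_∈_)
open import Data.List.Membership.Propositional.Properties using (∈-lookup; ∈-map⁺; ∈-map⁻; ∈-++⁺ˡ; ∈-++⁺ʳ)
open import Data.List.Properties using (unfold-reverse; reverse-involutive; length-++; length-map; ∷-injectiveʳ)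
import Data.List.Properties as List
open import Data.List.Relation.Unary.All as All using (All; []; _∷_)
import Data.List.Relation.Unary.All.Properties as All
open import Data.List.Relation.Unary.AllPairs using ([]; _∷_)
open import Data.List.Relation.Unary.Any as Any using (here)
import Data.List.Relation.Unary.Any.Properties as Any
open import Data.List.Relation.Unary.Unique.Propositional using (Unique)
import Data.List.Relation.Unary.Unique.Propositional.Properties as Unique
open import Data.Maybe using (Maybe; just; nothing)
open import Data.Nat using (ℕ; zero; suc; _+_; _*_; _∸_; ∣_-_∣; _≤_; _<_; z≤n; s≤s; _≟_; _≤?_; _<?_; NonZero; >-nonZero; >-nonZero⁻¹)
open import Data.Nat.Divisibility using (_∣_; divides; _∣?_; ∣m+n∣m⇒∣n; ∣-trans; 1∣_; ∣m⇒∣m*n; ∣n⇒∣m*n; ∣1⇒≡1; ∣-reflexive)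
open import Data.Nat.GCD using (gcd; gcd[m,n]∣m; gcd[m,n]∣n; gcd-GCD; module Bézout)
open import Data.Nat.Induction using (<-rec)
import Data.Nat.Properties as ℕ
import Data.Nat.Tactic.RingSolver as ℕ-Solver
open import Data.Product using (_×_; _,_; Σ; ∃; ∃₂; proj₁; proj₂)
import Data.Product.Properties as Product
open import Data.Sum using (_⊎_; inj₁; inj₂; [_,_]′)
open import Data.Vec.Functional using (insertAt)
open import Data.Vec.Functional.Properties using (insertAt-lookup; insertAt-punchIn)
open import Relation.Binary.Definitions using (DecidableEquality)
open import Relation.Binary.PropositionalEquality using (_≡_; _≢_; _≗_; refl; sym; trans; cong; cong₂; subst; module ≡-Reasoning)
import Relation.Binary.Reasoning.Setoid
open import Relation.Nullary using (¬_; Dec; yes; no; contradiction; does; ¬?)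
open import Relation.Nullary.Decidable using (_×-dec_; _⊎-dec_; dec-true; dec-false; decidable-stable; from-yes)
open import Tactic.RingSolver using (solve-∀)
open import Tactic.RingSolver.Core.AlmostCommutativeRing using (AlmostCommutativeRing; fromCommutativeRing)
open import Algebra.Properties.Group (AbelianGroup.group ℤ.+-0-abelianGroup) using () renaming (∙-cancelʳ to ℤ-+-cancelʳ)
open import Algebra.Properties.Semiring.Sum ℤ.+-*-semiring using (sum; sum-remove; sum-cong-≗; ∑-distrib-+; *-distribˡ-sum; sum-replicate-zero)

-- The ring of polynomials

infix 4 _≃_

-- _≈P_ as a record, so that both sides can be inferred from a proof.
record _≃_ (p r : Poly) : Set where
  constructor mk
  field at : p ≈P r
open _≃_

coeff-+ : ∀ p r i → coeff (p +P r) i ≡ coeff p i ℤ.+ coeff r i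
coeff-+ []      r       i       = sym (ℤ.+-identityˡ _)
coeff-+ (a ∷ p) []      i       = sym (ℤ.+-identityʳ _)
coeff-+ (a ∷ p) (b ∷ r) zero    = refl
coeff-+ (a ∷ p) (b ∷ r) (suc i) = coeff-+ p r i

coeff-scale : ∀ c p i → coeff (scale c p) i ≡ c ℤ.* coeff p i
coeff-scale c []      i       = sym (ℤ.*-zeroʳ c)
coeff-scale c (a ∷ p) zero    = refl
coeff-scale c (a ∷ p) (suc i) = coeff-scale c p i

≃-refl : ∀ {p} → p ≃ p
≃-refl .at i = refl

≃-sym : ∀ {p r} → p ≃ r → r ≃ p
≃-sym e .at i = sym (e .at i)

≃-trans : ∀ {p r s} → p ≃ r → r ≃ s → p ≃ s
≃-trans e f .at i = trans (e .at i) (f .at i)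

infixr 2 _⊙_
_⊙_ : ∀ {p r s} → p ≃ r → r ≃ s → p ≃ s
_⊙_ = ≃-trans

∷-cong : ∀ {a b p r} → a ≡ b → p ≃ r → a ∷ p ≃ b ∷ r
∷-cong e f .at zero    = e
∷-cong e f .at (suc i) = f .at i

+P-cong : ∀ {p p′ r r′} → p ≃ p′ → r ≃ r′ → p +P r ≃ p′ +P r′
+P-cong {p} {p′} {r} {r′} e f .at i =
  trans (coeff-+ p r i) (trans (cong₂ ℤ._+_ (e .at i) (f .at i)) (sym (coeff-+ p′ r′ i)))

scale-cong : ∀ c {p r} → p ≃ r → scale c p ≃ scale c r
scale-cong c {p} {r} e .at i =
  trans (coeff-scale c p i) (trans (cong (c ℤ.*_) (e .at i)) (sym (coeff-scale c r i)))

+P-assoc : ∀ p r s → (p +P r) +P s ≃ p +P (r +P s)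
+P-assoc p r s .at i
  rewrite coeff-+ (p +P r) s i | coeff-+ p r i | coeff-+ p (r +P s) i | coeff-+ r s i
  = ℤ.+-assoc (coeff p i) _ _

+P-comm : ∀ p r → p +P r ≃ r +P p
+P-comm p r .at i rewrite coeff-+ p r i | coeff-+ r p i = ℤ.+-comm (coeff p i) _

+P-interchange : ∀ p r s t → (p +P r) +P (s +P t) ≃ (p +P s) +P (r +P t)
+P-interchange p r s t .at i
  rewrite coeff-+ (p +P r) (s +P t) i | coeff-+ p r i | coeff-+ s t i
        | coeff-+ (p +P s) (r +P t) i | coeff-+ p s i | coeff-+ r t i
  = lemma (coeff p i) (coeff r i) (coeff s i) (coeff t i)
  where
  lemma : ∀ a b c d → (a ℤ.+ b) ℤ.+ (c ℤ.+ d) ≡ (a ℤ.+ c) ℤ.+ (b ℤ.+ d)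
  lemma = ℤ-Solver.solve-∀

+P-identityʳ : ∀ p → p +P [] ≃ p
+P-identityʳ p = +P-comm p []

-P_ : Poly → Poly
-P []      = []
-P (a ∷ p) = ℤ.- a ∷ -P p

coeff-neg : ∀ p i → coeff (-P p) i ≡ ℤ.- coeff p i
coeff-neg []      i       = refl
coeff-neg (a ∷ p) zero    = refl
coeff-neg (a ∷ p) (suc i) = coeff-neg p i

-P-cong : ∀ {p r} → p ≃ r → -P p ≃ -P r
-P-cong {p} {r} e .at i =
  trans (coeff-neg p i) (trans (cong ℤ.-_ (e .at i)) (sym (coeff-neg r i)))

-P-inverseˡ : ∀ p → -P p +P p ≃ []
-P-inverseˡ p .at i rewrite coeff-+ (-P p) p i | coeff-neg p i = ℤ.+-inverseˡ (coeff p i)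

scale-zero : ∀ p → scale 0ℤ p ≃ []
scale-zero p .at i = coeff-scale 0ℤ p i

scale-one : ∀ p → scale 1ℤ p ≃ p
scale-one p .at i = trans (coeff-scale 1ℤ p i) (ℤ.*-identityˡ _)

scale-+ : ∀ a b p → scale (a ℤ.+ b) p ≃ scale a p +P scale b p
scale-+ a b p .at i
  rewrite coeff-scale (a ℤ.+ b) p i | coeff-+ (scale a p) (scale b p) i
        | coeff-scale a p i | coeff-scale b p i
  = ℤ.*-distribʳ-+ (coeff p i) a b

scale-+P : ∀ a p r → scale a (p +P r) ≃ scale a p +P scale a r
scale-+P a p r .at i
  rewrite coeff-scale a (p +P r) i | coeff-+ (scale a p) (scale a r) i
        | coeff-scale a p i | coeff-scale a r i | coeff-+ p r i
  = ℤ.*-distribˡ-+ a _ _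

scale-scale : ∀ a b p → scale a (scale b p) ≃ scale (a ℤ.* b) p
scale-scale a b p .at i
  rewrite coeff-scale a (scale b p) i | coeff-scale b p i | coeff-scale (a ℤ.* b) p i
  = sym (ℤ.*-assoc a b _)

0∷[] : 0ℤ ∷ [] ≃ []
0∷[] .at zero    = refl
0∷[] .at (suc i) = refl

scale-0∷ : ∀ a p → scale a (0ℤ ∷ p) ≃ 0ℤ ∷ scale a p
scale-0∷ a p = ∷-cong (ℤ.*-zeroʳ a) ≃-refl

*P-congˡ : ∀ p {r s} → r ≃ s → p *P r ≃ p *P s
*P-congˡ []      e = ≃-refl
*P-congˡ (a ∷ p) e = +P-cong (scale-cong a e) (∷-cong refl (*P-congˡ p e))

*P-zeroʳ : ∀ p → p *P [] ≃ []
*P-zeroʳ []      = ≃-refl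
*P-zeroʳ (a ∷ p) = ∷-cong refl (*P-zeroʳ p) ⊙ 0∷[]

*P-distribʳ : ∀ s p r → (p +P r) *P s ≃ p *P s +P r *P s
*P-distribʳ s []      r       = ≃-refl
*P-distribʳ s (a ∷ p) []      = ≃-sym (+P-identityʳ _)
*P-distribʳ s (a ∷ p) (b ∷ r) =
  +P-cong (scale-+ a b s) (∷-cong refl (*P-distribʳ s p r))
  ⊙ +P-interchange (scale a s) (scale b s) (0ℤ ∷ (p *P s)) (0ℤ ∷ (r *P s))

-- `_*P_` recurses on its first factor; this is the mirror rule for the second, from which
-- commutativity follows by induction.
*P-∷ : ∀ p a r → p *P (a ∷ r) ≃ scale a p +P (0ℤ ∷ (p *P r))
*P-∷ []      a r = ≃-sym 0∷[]
*P-∷ (b ∷ p) a r =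
  ∷-cong (trans (ℤ.+-identityʳ _) (trans (ℤ.*-comm b a) (sym (ℤ.+-identityʳ _))))
    (+P-cong ≃-refl (*P-∷ p a r)
     ⊙ ≃-sym (+P-assoc (scale b r) (scale a p) _)
     ⊙ +P-cong (+P-comm (scale b r) (scale a p)) ≃-refl
     ⊙ +P-assoc (scale a p) (scale b r) _)

*P-comm : ∀ p r → p *P r ≃ r *P p
*P-comm []      r = ≃-sym (*P-zeroʳ r)
*P-comm (a ∷ p) r = +P-cong ≃-refl (∷-cong refl (*P-comm p r)) ⊙ ≃-sym (*P-∷ r a p)

*P-congʳ : ∀ {p r} s → p ≃ r → p *P s ≃ r *P s
*P-congʳ {p} {r} s e = *P-comm p s ⊙ *P-congˡ s e ⊙ *P-comm s r

*P-cong : ∀ {p p′ r r′} → p ≃ p′ → r ≃ r′ → p *P r ≃ p′ *P r′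
*P-cong {p′ = p′} {r} e f = *P-congʳ r e ⊙ *P-congˡ p′ f

scale-*P : ∀ a p r → scale a p *P r ≃ scale a (p *P r)
scale-*P a []      r = ≃-refl
scale-*P a (b ∷ p) r =
  +P-cong (≃-sym (scale-scale a b r)) (∷-cong refl (scale-*P a p r) ⊙ ≃-sym (scale-0∷ a (p *P r)))
  ⊙ ≃-sym (scale-+P a (scale b r) (0ℤ ∷ (p *P r)))

0∷-*P : ∀ p r → (0ℤ ∷ p) *P r ≃ 0ℤ ∷ (p *P r)
0∷-*P p r = +P-cong (scale-zero r) ≃-refl

*P-assoc : ∀ p r s → (p *P r) *P s ≃ p *P (r *P s)
*P-assoc []      r s = ≃-refl
*P-assoc (a ∷ p) r s =
  *P-distribʳ s (scale a r) (0ℤ ∷ (p *P r))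
  ⊙ +P-cong (scale-*P a r s) (0∷-*P (p *P r) s ⊙ ∷-cong refl (*P-assoc p r s))

1P : Poly
1P = 1ℤ ∷ []

*P-identityˡ : ∀ p → 1P *P p ≃ p
*P-identityˡ p = +P-cong (scale-one p) 0∷[] ⊙ +P-identityʳ p

polyRing : CommutativeRing _ _
polyRing = record
  { Carrier = Poly ; _≈_ = _≃_ ; _+_ = _+P_ ; _*_ = _*P_ ; -_ = -P_ ; 0# = [] ; 1# = 1P
  ; isCommutativeRing = record
    { isRing = record
      { +-isAbelianGroup = record
        { isGroup = record
          { isMonoid = record
            { isSemigroup = record
              { isMagma = record
                { isEquivalence = record { refl = ≃-refl ; sym = ≃-sym ; trans = ≃-trans }
                ; ∙-cong = +P-cong }
              ; assoc = +P-assoc }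
            ; identity = (λ _ → ≃-refl) , +P-identityʳ }
          ; inverse = -P-inverseˡ , λ p → +P-comm p (-P p) ⊙ -P-inverseˡ p
          ; ⁻¹-cong = -P-cong }
        ; comm = +P-comm }
      ; *-cong = *P-cong
      ; *-assoc = *P-assoc
      ; *-identity = *P-identityˡ , λ p → *P-comm p 1P ⊙ *P-identityˡ p
      ; distrib = (λ p r s → *P-comm p (r +P s) ⊙ *P-distribʳ p r s ⊙ +P-cong (*P-comm r p) (*P-comm s p))
                , *P-distribʳ }
    ; *-comm = *P-comm } }

-- Gaussian polynomials

module P = CommutativeRing polyRing
module ≃-Reasoning = Relation.Binary.Reasoning.Setoid P.setoid

zero? : ∀ p → Maybe ([] ≃ p)
zero? []      = just ≃-refl
zero? (a ∷ p) with 0ℤ ℤ.≟ a | zero? p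
... | yes refl | just e = just (≃-sym 0∷[] ⊙ ∷-cong refl e)
... | _        | _      = nothing

polyACR : AlmostCommutativeRing _ _
polyACR = fromCommutativeRing polyRing zero?

*-+-shuffle : ∀ e x q y → e *P (x +P q *P y) ≃ e *P x +P q *P (e *P y)
*-+-shuffle = solve-∀ polyACR

factor-right : ∀ e x q f → e *P x +P q *P (f *P x) ≃ (e +P q *P f) *P x
factor-right = solve-∀ polyACR

pull-factor : ∀ g a e b → g *P ((a *P e) *P b) ≃ (e *P g) *P (a *P b)
pull-factor = solve-∀ polyACR

shift : ℕ → Poly → Poly
shift m p = replicate m 0ℤ ++ p

E : ℕ → Poly
E = oneMinusQ^

Q : ℕ → Poly
Q m = shift m 1P

coeff-shift-+ : ∀ m p i → coeff (shift m p) (m + i) ≡ coeff p i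
coeff-shift-+ zero    p i = refl
coeff-shift-+ (suc m) p i = coeff-shift-+ m p i

coeff-shift-< : ∀ m p {i} → i < m → coeff (shift m p) i ≡ 0ℤ
coeff-shift-< (suc m) p {zero}  _         = refl
coeff-shift-< (suc m) p {suc i} (s≤s i<m) = coeff-shift-< m p i<m

shift-cong : ∀ m {p r} → p ≃ r → shift m p ≃ shift m r
shift-cong zero    e = e
shift-cong (suc m) e = ∷-cong refl (shift-cong m e)

shift-neg : ∀ m p → shift m (-P p) ≡ -P shift m p
shift-neg zero    p = refl
shift-neg (suc m) p = cong (0ℤ ∷_) (shift-neg m p)

shift-*P : ∀ m p r → shift m p *P r ≃ shift m (p *P r)
shift-*P zero    p r = ≃-refl
shift-*P (suc m) p r = 0∷-*P (shift m p) r ⊙ ∷-cong refl (shift-*P m p r)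

Q-*P : ∀ m p → Q m *P p ≃ shift m p
Q-*P m p = shift-*P m 1P p ⊙ shift-cong m (*P-identityˡ p)

shift-shift : ∀ m n p → shift (m + n) p ≡ shift m (shift n p)
shift-shift zero    n p = refl
shift-shift (suc m) n p = cong (0ℤ ∷_) (shift-shift m n p)

Q-+ : ∀ m n → Q (m + n) ≃ Q m *P Q n
Q-+ m n = ≃-sym (Q-*P m (Q n) ⊙ subst (shift m (Q n) ≃_) (sym (shift-shift m n 1P)) ≃-refl)

E-def : ∀ m → E m ≃ 1P +P -P Q m
E-def m rewrite shift-neg m 1P = ≃-refl

E-+ : ∀ m n → E (m + n) ≃ E m +P Q m *P E n
E-+ m n = begin
  E (m + n)                                 ≈⟨ E-def (m + n) ⟩
  1P +P -P Q (m + n)                        ≈⟨ +P-cong (≃-refl {1P}) (P.-‿cong (Q-+ m n)) ⟩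
  1P +P -P (Q m *P Q n)                     ≈⟨ 1-xy (Q m) (Q n) ⟩
  (1P +P -P Q m) +P Q m *P (1P +P -P Q n)   ≈⟨ +P-cong (E-def m) (*P-congˡ (Q m) (E-def n)) ⟨
  E m +P Q m *P E n                         ∎
  where
  open ≃-Reasoning
  1-xy : ∀ x y → 1P +P -P (x *P y) ≃ (1P +P -P x) +P x *P (1P +P -P y)
  1-xy = solve-∀ polyACR

-- The q-binomial [k+l, k] by the q-Pascal rule; taking the two complementary sizes as arguments
-- avoids truncated subtraction.
gauss : ℕ → ℕ → Poly
gauss zero    l       = 1P
gauss (suc k) zero    = 1P
gauss (suc k) (suc l) = gauss k (suc l) +P shift (suc k) (gauss (suc k) l)

gauss-zeroʳ : ∀ k → gauss k zero ≡ 1P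
gauss-zeroʳ zero    = refl
gauss-zeroʳ (suc k) = refl

gauss-suc : ∀ k l → gauss (suc k) (suc l) ≃ gauss k (suc l) +P Q (suc k) *P gauss (suc k) l
gauss-suc k l = +P-cong ≃-refl (≃-sym (Q-*P (suc k) (gauss (suc k) l)))

mutual
  -- Simultaneous induction: after the q-Pascal rule, both identities for the smaller pair have the
  -- same right-hand side, so their left-hand sides may be exchanged; `E-+` then merges the factors.
  gauss-ratioˡ : ∀ k l → E (suc k) *P gauss (suc k) l ≃ E (suc (k + l)) *P gauss k l
  gauss-ratioˡ k zero rewrite gauss-zeroʳ k | ℕ.+-identityʳ k = ≃-refl
  gauss-ratioˡ k (suc l) = begin
    E (suc k) *P gauss (suc k) (suc l)
      ≈⟨ *P-congˡ (E (suc k)) (gauss-suc k l) ⟩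
    E (suc k) *P (gauss k (suc l) +P Q (suc k) *P gauss (suc k) l)
      ≈⟨ *-+-shuffle (E (suc k)) (gauss k (suc l)) (Q (suc k)) (gauss (suc k) l) ⟩
    E (suc k) *P gauss k (suc l) +P Q (suc k) *P (E (suc k) *P gauss (suc k) l)
      ≈⟨ +P-cong (≃-refl {E (suc k) *P gauss k (suc l)}) (*P-congˡ (Q (suc k)) (gauss-ratioˡ k l ⊙ ≃-sym (gauss-ratioʳ k l))) ⟩
    E (suc k) *P gauss k (suc l) +P Q (suc k) *P (E (suc l) *P gauss k (suc l))
      ≈⟨ factor-right (E (suc k)) (gauss k (suc l)) (Q (suc k)) (E (suc l)) ⟩
    (E (suc k) +P Q (suc k) *P E (suc l)) *P gauss k (suc l)
      ≈⟨ *P-congʳ (gauss k (suc l)) (E-+ (suc k) (suc l)) ⟨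
    E (suc (k + suc l)) *P gauss k (suc l) ∎
    where open ≃-Reasoning

  gauss-ratioʳ : ∀ k l → E (suc l) *P gauss k (suc l) ≃ E (suc (k + l)) *P gauss k l
  gauss-ratioʳ zero    l = ≃-refl
  gauss-ratioʳ (suc k) l = begin
    E (suc l) *P gauss (suc k) (suc l)
      ≈⟨ *P-congˡ (E (suc l)) (gauss-suc k l) ⟩
    E (suc l) *P (gauss k (suc l) +P Q (suc k) *P gauss (suc k) l)
      ≈⟨ *-+-shuffle (E (suc l)) (gauss k (suc l)) (Q (suc k)) (gauss (suc k) l) ⟩
    E (suc l) *P gauss k (suc l) +P Q (suc k) *P (E (suc l) *P gauss (suc k) l)
      ≈⟨ +P-cong (gauss-ratioʳ k l ⊙ ≃-sym (gauss-ratioˡ k l)) ≃-refl ⟩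
    E (suc k) *P gauss (suc k) l +P Q (suc k) *P (E (suc l) *P gauss (suc k) l)
      ≈⟨ factor-right (E (suc k)) (gauss (suc k) l) (Q (suc k)) (E (suc l)) ⟩
    (E (suc k) +P Q (suc k) *P E (suc l)) *P gauss (suc k) l
      ≈⟨ *P-congʳ (gauss (suc k) l) (E-+ (suc k) (suc l)) ⟨
    E (suc (k + suc l)) *P gauss (suc k) l
      ≡⟨ cong (λ j → E (suc j) *P gauss (suc k) l) (ℕ.+-suc k l) ⟩
    E (suc (suc k + l)) *P gauss (suc k) l ∎
    where open ≃-Reasoning

-- Links the recursive `gauss` to the defining quotient of q-factorials, with one use of
-- `gauss-ratioˡ` for each step in k.
gauss-product : ∀ k l → gauss k l *P (qPoch k *P qPoch l) ≃ qPoch (k + l)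
gauss-product zero    l = *P-identityˡ (1P *P qPoch l) ⊙ *P-identityˡ (qPoch l)
gauss-product (suc k) l = begin
  gauss (suc k) l *P ((qPoch k *P E (suc k)) *P qPoch l)
    ≈⟨ pull-factor (gauss (suc k) l) (qPoch k) (E (suc k)) (qPoch l) ⟩
  (E (suc k) *P gauss (suc k) l) *P (qPoch k *P qPoch l)
    ≈⟨ *P-congʳ _ (gauss-ratioˡ k l) ⟩
  (E (suc (k + l)) *P gauss k l) *P (qPoch k *P qPoch l)
    ≈⟨ *P-assoc (E (suc (k + l))) (gauss k l) _ ⟩
  E (suc (k + l)) *P (gauss k l *P (qPoch k *P qPoch l))
    ≈⟨ *P-congˡ (E (suc (k + l))) (gauss-product k l) ⟩
  E (suc (k + l)) *P qPoch (k + l)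
    ≈⟨ *P-comm (E (suc (k + l))) (qPoch (k + l)) ⟩
  qPoch (k + l) *P E (suc (k + l)) ∎
  where open ≃-Reasoning

-- Divisibility by 1 - q^m

*P-swap : ∀ x y z → x *P (y *P z) ≃ y *P (x *P z)
*P-swap = solve-∀ polyACR

E-*P : ∀ m p → E m *P p ≃ p +P -P shift m p
E-*P m p = *P-congʳ p (E-def m) ⊙ expand p (Q m) ⊙ +P-cong (≃-refl {p}) (-P-cong (Q-*P m p))
  where
  expand : ∀ p x → (1P +P -P x) *P p ≃ p +P -P (x *P p)
  expand = solve-∀ polyACR

coeff-E* : ∀ m p i → coeff (E m *P p) i ≡ coeff p i ℤ.- coeff (shift m p) i
coeff-E* m p i =
  trans (E-*P m p .at i)
    (trans (coeff-+ p (-P shift m p) i) (cong (λ z → coeff p i ℤ.+ z) (coeff-neg (shift m p) i)))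

coeff-E*-< : ∀ m p {i} → i < m → coeff (E m *P p) i ≡ coeff p i
coeff-E*-< m p {i} i<m =
  trans (coeff-E* m p i)
    (trans (cong (λ z → coeff p i ℤ.- z) (coeff-shift-< m p i<m)) (ℤ.+-identityʳ _))

coeff-E*-+ : ∀ m p i → coeff (E m *P p) (m + i) ≡ coeff p (m + i) ℤ.- coeff p i
coeff-E*-+ m p i =
  trans (coeff-E* m p (m + i)) (cong (λ z → coeff p (m + i) ℤ.- z) (coeff-shift-+ m p i))

-- In a product with 1 - q^m, coefficient m + i involves only the indices m + i and i of the other
-- factor, so arguments on coefficients advance by m.
step-induction : ∀ m .{{_ : NonZero m}} (Pr : ℕ → Set) →
  (∀ {i} → i < m → Pr i) → (∀ i → Pr i → Pr (m + i)) → ∀ i → Pr i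
step-induction (suc m) Pr base step = <-rec Pr go
  where
  go : ∀ i → (∀ {j} → j < i → Pr j) → Pr i
  go i rec with i <? suc m
  ... | yes i<m = base i<m
  ... | no  i≮m = subst Pr eq (step (i ∸ suc m) (rec (subst (i ∸ suc m <_) eq (s≤s (ℕ.m≤n+m _ m)))))
    where
    eq : suc m + (i ∸ suc m) ≡ i
    eq = ℕ.m+[n∸m]≡n (ℕ.≮⇒≥ i≮m)

E-cancelˡ : ∀ m .{{_ : NonZero m}} {p r} → E m *P p ≃ E m *P r → p ≃ r
E-cancelˡ m {p} {r} e .at = step-induction m (λ i → coeff p i ≡ coeff r i)
  (λ {i} i<m → trans (sym (coeff-E*-< m p i<m)) (trans (e .at i) (coeff-E*-< m r i<m)))
  (λ i ih → ℤ-+-cancelʳ (ℤ.- coeff p i) _ _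
    (trans (sym (coeff-E*-+ m p i)) (trans (e .at (m + i))
      (trans (coeff-E*-+ m r i) (cong (λ z → coeff r (m + i) ℤ.- z) (sym ih))))))

const : ℤ → Poly
const c = c ∷ []

const-*P : ∀ c p → const c *P p ≃ scale c p
const-*P c p = +P-cong (≃-refl {scale c p}) 0∷[] ⊙ +P-identityʳ (scale c p)

coeff-const* : ∀ c p i → coeff (const c *P p) i ≡ c ℤ.* coeff p i
coeff-const* c p i = trans (const-*P c p .at i) (coeff-scale c p i)

extract-content : ∀ c p → (∀ i → ∃ λ z → coeff p i ≡ c ℤ.* z) → ∃ λ r → p ≃ scale c r
extract-content c []      h = [] , ≃-refl
extract-content c (a ∷ p) h =
  let r , e = extract-content c p (λ i → h (suc i))
      z , e₀ = h 0
  in z ∷ r , ∷-cong e₀ e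

-- Since 1 - q^m has constant term 1, r_i = c p_i for i < m and r_(m+i) = c p_(m+i) + r_i; hence c
-- divides every coefficient of r and cancels.
content-cancel : ∀ m .{{_ : NonZero m}} {c} → c ≢ 0ℤ → ∀ {p r} →
  const c *P p ≃ E m *P r → ∃ λ s → p ≃ E m *P s
content-cancel m {c} c≢0 {p} {r} e = s , p≃
  where
  divisible : ∀ i → ∃ λ z → coeff r i ≡ c ℤ.* z
  divisible = step-induction m _
    (λ {i} i<m → coeff p i , trans (sym (coeff-E*-< m r i<m)) (trans (sym (e .at i)) (coeff-const* c p i)))
    (λ { i (z , eq) → coeff p (m + i) ℤ.+ z ,
      (begin
        coeff r (m + i)
          ≡⟨ add-sub (coeff r (m + i)) (coeff r i) ⟩
        (coeff r (m + i) ℤ.- coeff r i) ℤ.+ coeff r i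
          ≡⟨ cong₂ ℤ._+_ (trans (sym (coeff-E*-+ m r i)) (trans (sym (e .at (m + i))) (coeff-const* c p (m + i)))) eq ⟩
        c ℤ.* coeff p (m + i) ℤ.+ c ℤ.* z
          ≡⟨ ℤ.*-distribˡ-+ c (coeff p (m + i)) z ⟨
        c ℤ.* (coeff p (m + i) ℤ.+ z) ∎) })
    where
    open ≡-Reasoning
    add-sub : ∀ x y → x ≡ (x ℤ.- y) ℤ.+ y
    add-sub = ℤ-Solver.solve-∀
  s : Poly
  s = proj₁ (extract-content c r divisible)
  r≃ : r ≃ const c *P s
  r≃ = proj₂ (extract-content c r divisible) ⊙ ≃-sym (const-*P c s)
  cp≃ : const c *P p ≃ const c *P (E m *P s)
  cp≃ = e ⊙ *P-congˡ (E m) r≃ ⊙ *P-swap (E m) (const c) s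
  p≃ : p ≃ E m *P s
  p≃ .at i = ℤ.*-cancelˡ-≡ c _ _ {{ℤ.≢-nonZero c≢0}}
    (trans (sym (coeff-const* c p i)) (trans (cp≃ .at i) (coeff-const* c (E m *P s) i)))

-- Bézout identities for the polynomials 1 - q^a

E-zero : E 0 ≃ []
E-zero = 0∷[]

-- geo s g = (1 - q^(s g)) / (1 - q^g)
geo : ℕ → ℕ → Poly
geo zero    g = []
geo (suc s) g = 1P +P Q g *P geo s g

E-geo : ∀ s g → E (s * g) ≃ geo s g *P E g
E-geo zero    g = E-zero
E-geo (suc s) g =
  E-+ g (s * g) ⊙ +P-cong (≃-refl {E g}) (*P-congˡ (Q g) (E-geo s g)) ⊙ collect (E g) (Q g) (geo s g)
  where
  collect : ∀ e x y → e +P x *P (y *P e) ≃ (1P +P x *P y) *P e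
  collect = solve-∀ polyACR

-- Modulo 1 - q^g every power of q^g is 1, so the geometric sum takes the value s.
geo-eval : ∀ s g → ∃ λ z → geo s g ≃ const (+ s) +P E g *P z
geo-eval zero    g = [] , (≃-sym 0∷[] ⊙ ≃-sym (+P-identityʳ (const 0ℤ)) ⊙ +P-cong (≃-refl {const 0ℤ}) (≃-sym (*P-zeroʳ (E g))))
geo-eval (suc s) g =
  let z , e = geo-eval s g in
  z +P -P geo s g ,
  (+P-cong (≃-refl {1P}) (*P-congʳ (geo s g) Q≃)
   ⊙ expand (E g) (geo s g)
   ⊙ +P-cong (+P-cong (≃-refl {1P}) e) (≃-refl { -P (E g *P geo s g)})
   ⊙ collect (const (+ s)) (E g) z (geo s g))
  where
  Q≃ : Q g ≃ 1P +P -P E g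
  Q≃ = lemma (Q g) ⊙ +P-cong (≃-refl {1P}) (-P-cong (≃-sym (E-def g)))
    where
    lemma : ∀ x → x ≃ 1P +P -P (1P +P -P x)
    lemma = solve-∀ polyACR
  expand : ∀ e y → 1P +P (1P +P -P e) *P y ≃ (1P +P y) +P -P (e *P y)
  expand = solve-∀ polyACR
  collect : ∀ c e z y → (1P +P (c +P e *P z)) +P -P (e *P y) ≃ (1P +P c) +P e *P (z +P -P y)
  collect = solve-∀ polyACR

-- As x a = d + y b, 1 - q^(x a) = (1 - q^d) + q^d (1 - q^(y b)), where 1 - q^(x a) and 1 - q^(y b)
-- are multiples of `E a` and `E b`.
E-combination : ∀ x a y b {d} → d + y * b ≡ x * a →
  geo x a *P E a +P (-P (Q d *P geo y b)) *P E b ≃ E d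
E-combination x a y b {d} eq =
  +P-cong E-xa (≃-refl {(-P (Q d *P geo y b)) *P E b}) ⊙ cancel (E d) (Q d) (geo y b) (E b)
  where
  E-xa : geo x a *P E a ≃ E d +P Q d *P (geo y b *P E b)
  E-xa = ≃-sym (E-geo x a) ⊙ subst (λ j → E j ≃ E d +P Q d *P (geo y b *P E b)) eq
           (E-+ d (y * b) ⊙ +P-cong (≃-refl {E d}) (*P-congˡ (Q d) (E-geo y b)))
  cancel : ∀ e x y f → (e +P x *P (y *P f)) +P (-P (x *P y)) *P f ≃ e
  cancel = solve-∀ polyACR

E-bézout : ∀ a b → ∃₂ λ u v → u *P E a +P v *P E b ≃ E (gcd a b)
E-bézout a b with Bézout.identity (gcd-GCD a b)
... | Bézout.+- x y eq = geo x a , -P (Q (gcd a b) *P geo y b) , E-combination x a y b eq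
... | Bézout.-+ x y eq = -P (Q (gcd a b) *P geo x a) , geo y b ,
  (+P-comm (-P (Q (gcd a b) *P geo x a) *P E a) (geo y b *P E b) ⊙ E-combination y b x a eq)

-- Let w = (1 - q^a)/(1 - q^g). Dividing `E-bézout` by 1 - q^g makes w invertible modulo (1 -
-- q^b)/(1 - q^g), while w = s + (1 - q^g) z by `geo-eval`. Multiplying the first relation by (1 -
-- q^g) z and substituting it in the second expresses s by w and 1 - q^b.
geo-unit : ∀ a b .{{_ : NonZero a}} → ∃ λ s → a ≡ s * gcd a b ×
  s ≢ 0 × ∃₂ λ u v → u *P geo s (gcd a b) +P v *P E b ≃ const (+ s)
geo-unit a@(suc _) b with gcd a b | gcd[m,n]∣m a b | gcd[m,n]∣n a b | E-bézout a b
... | zero        | divides s eq | _            | _ = contradiction (trans eq (ℕ.*-zeroʳ s)) λ ()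
... | g@(suc _)   | divides s eq | divides t eq′ | u , v , uv =
  s , eq , (λ { refl → contradiction eq λ () }) ,
  1P +P -P ((E g *P z) *P u) , -P (z *P v) , combination
  where
  z : Poly
  z = proj₁ (geo-eval s g)
  E-a : E a ≃ geo s g *P E g
  E-a = subst (λ j → E j ≃ geo s g *P E g) (sym eq) (E-geo s g)
  E-b : E b ≃ geo t g *P E g
  E-b = subst (λ j → E j ≃ geo t g *P E g) (sym eq′) (E-geo t g)
  coprime : u *P geo s g +P v *P geo t g ≃ 1P
  coprime = E-cancelˡ g
    (spread (E g) u (geo s g) v (geo t g)
     ⊙ +P-cong (*P-congˡ u (≃-sym E-a)) (*P-congˡ v (≃-sym E-b)) ⊙ uv ⊙ one (E g))
    where
    spread : ∀ e u x v y → e *P (u *P x +P v *P y) ≃ u *P (x *P e) +P v *P (y *P e)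
    spread = solve-∀ polyACR
    one : ∀ e → e ≃ e *P 1P
    one = solve-∀ polyACR
  combination : (1P +P -P ((E g *P z) *P u)) *P geo s g +P -P (z *P v) *P E b ≃ const (+ s)
  combination =
    +P-cong (≃-refl {(1P +P -P ((E g *P z) *P u)) *P geo s g}) (*P-congˡ (-P (z *P v)) E-b)
    ⊙ regroup (E g) z u v (geo s g) (geo t g)
    ⊙ +P-cong (proj₂ (geo-eval s g)) (-P-cong (*P-congˡ (E g *P z) coprime))
    ⊙ cancel (const (+ s)) (E g) z
    where
    regroup : ∀ e z u v x y → (1P +P -P ((e *P z) *P u)) *P x +P -P (z *P v) *P (y *P e)
      ≃ x +P -P ((e *P z) *P (u *P x +P v *P y))
    regroup = solve-∀ polyACR
    cancel : ∀ c e z → (c +P e *P z) +P -P ((e *P z) *P 1P) ≃ c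
    cancel = solve-∀ polyACR

-- Divisibility of x by 1 - q^m over ℚ, with denominators cleared.
record Torsion (m : ℕ) (x : Poly) : Set where
  constructor torsion
  field
    scalar   : ℤ
    nonzero  : scalar ≢ 0ℤ
    quotient : Poly
    equation : const scalar *P x ≃ E m *P quotient

torsion-resp : ∀ {m x y} → x ≃ y → Torsion m x → Torsion m y
torsion-resp e (torsion c c≢0 z eq) = torsion c c≢0 z (*P-congˡ (const c) (≃-sym e) ⊙ eq)

torsion-* : ∀ {m} p {x} → Torsion m x → Torsion m (p *P x)
torsion-* {m} p {x} (torsion c c≢0 z eq) =
  torsion c c≢0 (p *P z) (*P-swap (const c) p x ⊙ *P-congˡ p eq ⊙ *P-swap p (E m) z)

torsion-E : ∀ m x → Torsion m (E m *P x)
torsion-E m x = torsion 1ℤ (λ ()) x (*P-identityˡ (E m *P x))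

-- s x is u w x plus a multiple of 1 - q^m; the integer s is absorbed into the scalar.
torsion-unit : ∀ {m u v w s} → s ≢ 0ℤ → u *P w +P v *P E m ≃ const s →
  ∀ {x} → Torsion m (w *P x) → Torsion m x
torsion-unit {m} {u} {v} {w} {s} s≢0 unit {x} (torsion c c≢0 y eq) =
  torsion (c ℤ.* s) (λ cs≡0 → [ c≢0 , s≢0 ]′ (ℤ.i*j≡0⇒i≡0∨j≡0 c cs≡0)) (u *P y +P v *P (const c *P x))
  (*P-congʳ x (≃-sym const-*)
   ⊙ *P-congʳ x (*P-congˡ (const c) (≃-sym unit))
   ⊙ regroup (const c) u w v (E m) x
   ⊙ +P-cong (*P-congˡ u eq) (≃-refl {E m *P (v *P (const c *P x))})
   ⊙ collect u (E m) y (v *P (const c *P x)))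
  where
  const-* : const c *P const s ≃ const (c ℤ.* s)
  const-* = ∷-cong (ℤ.+-identityʳ (c ℤ.* s)) ≃-refl
  regroup : ∀ c u w v e x → (c *P (u *P w +P v *P e)) *P x ≃ u *P (c *P (w *P x)) +P e *P (v *P (c *P x))
  regroup = solve-∀ polyACR
  collect : ∀ u e y z → u *P (e *P y) +P e *P z ≃ e *P (u *P y +P z)
  collect = solve-∀ polyACR

E-∣ : ∀ {a b} → a ∣ b → ∃ λ z → E b ≃ z *P E a
E-∣ {a} (divides t refl) = geo t a , E-geo t a

-- By `gauss-ratioˡ`, (1 - q^(k+1)) `gauss (suc k) l` is a multiple of (1 - q^a) `gauss k l`. With g
-- the gcd, 1 - q^(k+1) is 1 - q^g times a unit modulo 1 - q^m over ℚ, so only 1 - q^g remains, and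
-- it divides 1 - q^d.
descend-changing : ∀ {m a k l} d → Torsion m (E a *P gauss k l) → a ∣ suc (k + l) → gcd (suc k) m ∣ d →
  Torsion m (E d *P gauss (suc k) l)
descend-changing {m} {a} {k} {l} d tor a∣ g∣d with geo-unit (suc k) m | E-∣ a∣ | E-∣ g∣d
... | s , eq , s≢0 , u , v , unit | z , Ez | z′ , Ez′ =
  torsion-resp (≃-sym (*P-assoc z′ (E g) G′) ⊙ *P-congʳ G′ (≃-sym Ez′)) (torsion-* z′
    (torsion-unit {u = u} {v} {geo s g} (λ { refl → s≢0 refl }) unit
      (torsion-resp chain (torsion-* z tor))))
  where
  g : ℕ
  g = gcd (suc k) m
  G′ : Poly
  G′ = gauss (suc k) l
  chain : z *P (E a *P gauss k l) ≃ geo s g *P (E g *P G′)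
  chain = ≃-sym (*P-assoc z (E a) (gauss k l)) ⊙ *P-congʳ (gauss k l) (≃-sym Ez) ⊙ ≃-sym (gauss-ratioˡ k l)
    ⊙ *P-congʳ G′ (subst (λ j → E j ≃ geo s g *P E g) (sym eq) (E-geo s g))
    ⊙ *P-assoc (geo s g) (E g) G′

-- Here 1 - q cancels from both sides of `gauss-ratioˡ`, so the factor 1 - q^a is carried along
-- unchanged for arbitrary a.
descend-coprime : ∀ {m a k l} → Torsion m (E a *P gauss k l) → gcd (suc k) m ≡ 1 →
  Torsion m (E a *P gauss (suc k) l)
descend-coprime {m} {a} {k} {l} tor g≡1 with geo-unit (suc k) m | E-∣ (1∣ suc (k + l))
... | s , eq , s≢0 , u , v , unit | z , Ez rewrite g≡1 =
  torsion-unit {u = u} {v} {geo s 1} (λ { refl → s≢0 refl }) unit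
    (torsion-resp (*P-swap z (E a) (gauss k l) ⊙ *P-congˡ (E a) reduced ⊙ *P-swap (E a) (geo s 1) G′) (torsion-* z tor))
  where
  G′ : Poly
  G′ = gauss (suc k) l
  rotate : ∀ x y z → x *P (y *P z) ≃ (y *P x) *P z
  rotate = solve-∀ polyACR
  reduced : z *P gauss k l ≃ geo s 1 *P G′
  reduced = E-cancelˡ 1
    (rotate (E 1) z (gauss k l) ⊙ *P-congʳ (gauss k l) (≃-sym Ez) ⊙ ≃-sym (gauss-ratioˡ k l)
     ⊙ *P-congʳ G′ (subst (λ j → E j ≃ geo s 1 *P E 1) (sym eq) (E-geo s 1))
     ⊙ ≃-sym (rotate (E 1) (geo s 1) G′))

∸-step : ∀ {j K} → j < K → K ∸ j ≡ suc (K ∸ suc j)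
∸-step {j} {suc K} (s≤s j≤K) = ℕ.+-∸-assoc 1 j≤K

-- Descent on the distance j to the index K

module Descent (m K L : ℕ) where

  -- With L fixed, index j concerns [K+L-j, K-j]; `a` records which factor 1 - q^a is still needed
  -- for divisibility by 1 - q^m.
  Reach : ℕ → ℕ → Set
  Reach a j = Torsion m (E a *P gauss (K ∸ j) L)

  step-changing : ∀ {a j} d → j < K → a ∣ (K + L) ∸ j → gcd (K ∸ j) m ∣ d → Reach a (suc j) → Reach d j
  step-changing {a} {j} d j<K a∣ g∣d tor =
    subst (λ i → Torsion m (E d *P gauss i L)) (sym eq)
      (descend-changing d tor (subst (a ∣_) (trans (ℕ.+-∸-comm L (ℕ.<⇒≤ j<K)) (cong (_+ L) eq)) a∣)
        (subst (λ i → gcd i m ∣ d) eq g∣d))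
    where
    eq : K ∸ j ≡ suc (K ∸ suc j)
    eq = ∸-step j<K

  step-coprime : ∀ {a j} → j < K → gcd (K ∸ j) m ≡ 1 → Reach a (suc j) → Reach a j
  step-coprime {a} {j} j<K g≡1 tor =
    subst (λ i → Torsion m (E a *P gauss i L)) (sym eq)
      (descend-coprime {a = a} tor (subst (λ i → gcd i m ≡ 1) eq g≡1))
    where
    eq : K ∸ j ≡ suc (K ∸ suc j)
    eq = ∸-step j<K

  steps-coprime : ∀ {a} t i → i + t ≤ K → (∀ {j} → i ≤ j → j < i + t → gcd (K ∸ j) m ≡ 1) →
    Reach a (i + t) → Reach a i
  steps-coprime {a} zero    i _  _ tor = subst (Reach a) (ℕ.+-identityʳ i) tor
  steps-coprime {a} (suc t) i le h tor rewrite ℕ.+-suc i t =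
    steps-coprime {a} t i (ℕ.<⇒≤ le) (λ i≤j j< → h i≤j (ℕ.m<n⇒m<1+n j<))
      (step-coprime {a} le (h (ℕ.m≤m+n i t) ℕ.≤-refl) tor)

  -- The factor 1 - q^d lost at the exceptional index j₀ is recovered from 1 - q^(K+L) at index 0.
  descent : ∀ {e} j₀ d → 1 ≤ j₀ → j₀ < e → e < K → m ∣ (K + L) ∸ e → d ∣ K + L →
    (∀ {j} → j ≤ e → j ≢ j₀ → gcd (K ∸ j) m ≡ 1) → gcd (K ∸ j₀) m ∣ d → Torsion m (E 1 *P gauss K L)
  descent {e} j₀ d 1≤j₀ j₀<e e<K m∣ d∣ coprime g∣d =
    step-changing {d} 1 (ℕ.≤-<-trans z≤n e<K) d∣ (∣-reflexive (coprime z≤n (ℕ.<⇒≢ 1≤j₀))) at-1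
    where
    gap : suc j₀ + (e ∸ suc j₀) ≡ e
    gap = ℕ.m+[n∸m]≡n j₀<e
    gap′ : 1 + (j₀ ∸ 1) ≡ j₀
    gap′ = ℕ.m+[n∸m]≡n 1≤j₀
    at-e : Reach 1 e
    at-e = step-changing {m} 1 e<K m∣ (∣-reflexive (coprime ℕ.≤-refl (λ e≡j₀ → ℕ.<⇒≢ j₀<e (sym e≡j₀))))
      (torsion-E m (gauss (K ∸ suc e) L))
    at-1+j₀ : Reach 1 (suc j₀)
    at-1+j₀ = steps-coprime {1} (e ∸ suc j₀) (suc j₀) (subst (_≤ K) (sym gap) (ℕ.<⇒≤ e<K))
      (λ {j} lo hi → coprime (ℕ.<⇒≤ (subst (j <_) gap hi)) (λ j≡j₀ → ℕ.<⇒≢ lo (sym j≡j₀)))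
      (subst (Reach 1) (sym gap) at-e)
    at-j₀ : Reach d j₀
    -- 1 divides every upper index, so the factor 1 - q can be given up here; the gcd at `j₀`
    -- divides d, and 1 - q^d becomes the new factor.
    at-j₀ = step-changing {1} d (ℕ.<-trans j₀<e e<K) (1∣ _) g∣d at-1+j₀
    at-1 : Reach d 1
    at-1 = steps-coprime {d} (j₀ ∸ 1) 1 (subst (_≤ K) (sym gap′) (ℕ.<⇒≤ (ℕ.<-trans j₀<e e<K)))
      (λ {j} lo hi → let j<j₀ = subst (j <_) gap′ hi in
        coprime (ℕ.<⇒≤ (ℕ.<-trans j<j₀ j₀<e)) (ℕ.<⇒≢ j<j₀))
      (subst (Reach d) (sym gap′) at-j₀)

-- Bounds for the greatest common divisors

∣-difference : ∀ {g a b} → g ∣ a → g ∣ b → g ∣ ∣ a - b ∣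
∣-difference {g} (divides x refl) (divides y refl) =
  divides ∣ x - y ∣ (sym (ℕ.*-distribʳ-∣-∣ g x y))

-- Modulo g the product M n is 1, so multiplication by n undoes multiplication by M.
∣-cancel-M : ∀ {g M n x} → 1 ≤ M * n → g ∣ M * n ∸ 1 → g ∣ M * x → g ∣ x
∣-cancel-M {g} {M} {n} {x} 1≤Mn g∣m g∣Mx =
  ∣m+n∣m⇒∣n (subst (g ∣_) eq (∣n⇒∣m*n n g∣Mx)) (∣m⇒∣m*n x g∣m)
  where
  open ≡-Reasoning
  swap : ∀ n M x → n * (M * x) ≡ (M * n) * x
  swap = ℕ-Solver.solve-∀
  eq : n * (M * x) ≡ (M * n ∸ 1) * x + x
  eq = begin
    n * (M * x)                  ≡⟨ swap n M x ⟩
    (M * n) * x                  ≡⟨ cong (_* x) (ℕ.m∸n+n≡m 1≤Mn) ⟨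
    (M * n ∸ 1 + 1) * x          ≡⟨ ℕ.*-distribʳ-+ x (M * n ∸ 1) 1 ⟩
    (M * n ∸ 1) * x + 1 * x      ≡⟨ cong (λ z → (M * n ∸ 1) * x + z) (ℕ.*-identityˡ x) ⟩
    (M * n ∸ 1) * x + x          ∎

-- α (κ n - j) - β (M n - 1) = β - α j when α κ = β M, and M is a unit modulo any divisor of M n - 1.
gcd-bound : ∀ κ M α β j d n → α * κ ≡ β * M → j ≤ κ * n → 1 ≤ M * n →
  ∣ β - α * j ∣ ∣ M * (M * (M * d)) → gcd (κ * n ∸ j) (M * n ∸ 1) ∣ d
gcd-bound κ M α β j d n ακ≡βM j≤κn 1≤Mn check =
  -- Three factors `M` are granted because of the value 8 = |4 - 3 * 4|, which must divide a power
  -- of M = 30 or M = 66, where the prime 2 occurs only once.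
  cancel (cancel (cancel (∣-trans g∣diff check)))
  where
  open ≡-Reasoning
  g a b : ℕ
  g = gcd (κ * n ∸ j) (M * n ∸ 1)
  a = α * (κ * n ∸ j)
  b = β * (M * n ∸ 1)
  cancel : ∀ {x} → g ∣ M * x → g ∣ x
  cancel = ∣-cancel-M {M = M} {n} 1≤Mn (gcd[m,n]∣n (κ * n ∸ j) (M * n ∸ 1))
  a+αj≡b+β : a + α * j ≡ b + β
  a+αj≡b+β = begin
    a + α * j                    ≡⟨ ℕ.*-distribˡ-+ α (κ * n ∸ j) j ⟨
    α * (κ * n ∸ j + j)          ≡⟨ cong (α *_) (ℕ.m∸n+n≡m j≤κn) ⟩
    α * (κ * n)                  ≡⟨ ℕ.*-assoc α κ n ⟨
    (α * κ) * n                  ≡⟨ cong (_* n) ακ≡βM ⟩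
    (β * M) * n                  ≡⟨ ℕ.*-assoc β M n ⟩
    β * (M * n)                  ≡⟨ cong (β *_) (ℕ.m∸n+n≡m 1≤Mn) ⟨
    β * (M * n ∸ 1 + 1)          ≡⟨ ℕ.*-distribˡ-+ β (M * n ∸ 1) 1 ⟩
    b + β * 1                    ≡⟨ cong (λ z → b + z) (ℕ.*-identityʳ β) ⟩
    b + β                        ∎
  diff : ∣ a - b ∣ ≡ ∣ β - α * j ∣
  diff = begin
    ∣ a - b ∣                    ≡⟨ ℕ.∣m+n-m+o∣≡∣n-o∣ β a b ⟨
    ∣ β + a - β + b ∣            ≡⟨ cong₂ ∣_-_∣ (ℕ.+-comm β a) (trans (ℕ.+-comm β b) (sym a+αj≡b+β)) ⟩
    ∣ a + β - a + α * j ∣        ≡⟨ ℕ.∣m+n-m+o∣≡∣n-o∣ a β (α * j) ⟩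
    ∣ β - α * j ∣                ∎
  g∣diff : g ∣ ∣ β - α * j ∣
  g∣diff = subst (g ∣_) diff
    (∣-difference (∣n⇒∣m*n α (gcd[m,n]∣m (κ * n ∸ j) (M * n ∸ 1))) (∣n⇒∣m*n β (gcd[m,n]∣n (κ * n ∸ j) (M * n ∸ 1))))

-- The quotient (1-q)/(1-q^(M n - 1)) [N n choose κ n], where N = κ + λ′ = e M.  The numbers α, β with
-- α κ = β M bound the gcds gcd(κ n - j, M n - 1) for j ≤ e: these are 1, except that for j = j₀ a
-- divisor d of e may occur.
record Family : Set where
  field N κ λ′ M e α β j₀ d : ℕ

-- All clauses are decidable and independent of n, so evaluation certifies a family for every n at
-- once.
Admissible : Family → Set
Admissible F =
  κ + λ′ ≡ N × N ≡ e * M × α * κ ≡ β * M × 1 ≤ j₀ × j₀ < e × e < κ × 2 ≤ M × d ∣ e ×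
  (∀ {j} → j < suc e → j ≡ j₀ ⊎ ∣ β - α * j ∣ ∣ M * (M * (M * 1))) × ∣ β - α * j₀ ∣ ∣ M * (M * (M * d))
  where open Family F

admissible? : ∀ F → Dec (Admissible F)
admissible? F =
  κ + λ′ ≟ N ×-dec N ≟ e * M ×-dec α * κ ≟ β * M ×-dec 1 ≤? j₀ ×-dec j₀ <? e ×-dec e <? κ ×-dec
  2 ≤? M ×-dec d ∣? e ×-dec
  ℕ.allUpTo? (λ j → j ≟ j₀ ⊎-dec ∣ β - α * j ∣ ∣? M * (M * (M * 1))) (suc e) ×-dec
  ∣ β - α * j₀ ∣ ∣? M * (M * (M * d))
  where open Family F

Quotient : ℕ → ℕ → ℕ → Set
Quotient m K L = ∃ λ A → E 1 *P gauss K L ≃ E m *P A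

quotient-exists : ∀ F → Admissible F → let open Family F in
  ∀ n → 1 ≤ n → Quotient (M * n ∸ 1) (κ * n) (λ′ * n)
quotient-exists F (κ+λ′≡N , N≡eM , ακ≡βM , 1≤j₀ , j₀<e , e<κ , 2≤M , d∣e , regular , special) n@(suc _) 1≤n =
  let torsion _ c≢0 _ eq = descent j₀ d 1≤j₀ j₀<e e<K m∣ d∣ coprime
                             (gcd-bound κ M α β j₀ d n ακ≡βM (ℕ.<⇒≤ (ℕ.<-trans j₀<e e<K)) 1≤Mn special)
  in content-cancel m {{>-nonZero (ℕ.m<n⇒0<n∸m 2≤Mn)}} c≢0 eq
  where
  open Family F
  m K : ℕ
  m = M * n ∸ 1
  K = κ * n
  open Descent m K (λ′ * n)
  2≤Mn : 2 ≤ M * n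
  2≤Mn = ℕ.≤-trans 2≤M (ℕ.m≤m*n M n)
  1≤Mn : 1 ≤ M * n
  1≤Mn = ℕ.<⇒≤ 2≤Mn
  e<K : e < K
  e<K = ℕ.<-≤-trans e<κ (ℕ.m≤m*n κ n)
  N≡ : K + λ′ * n ≡ e * (M * n)
  N≡ = trans (sym (ℕ.*-distribʳ-+ n κ λ′)) (trans (cong (_* n) (trans κ+λ′≡N N≡eM)) (ℕ.*-assoc e M n))
  m∣ : m ∣ (K + λ′ * n) ∸ e
  -- N n - e = e (M n) - e = e (M n - 1).
  m∣ = divides e (trans (cong₂ _∸_ N≡ (sym (ℕ.*-identityʳ e))) (sym (ℕ.*-distribˡ-∸ e (M * n) 1)))
  d∣ : d ∣ K + λ′ * n
  d∣ = subst (d ∣_) (sym N≡) (∣m⇒∣m*n (M * n) d∣e)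
  coprime : ∀ {j} → j ≤ e → j ≢ j₀ → gcd (K ∸ j) m ≡ 1
  coprime {j} j≤e j≢j₀ with regular (s≤s j≤e)
  ... | inj₁ j≡j₀  = contradiction j≡j₀ j≢j₀
  ... | inj₂ check = ∣1⇒≡1 (gcd-bound κ M α β j 1 n ακ≡βM (ℕ.<⇒≤ (ℕ.≤-<-trans j≤e e<K)) 1≤Mn check)

-- Linear algebra over ℤ

sum-zero : ∀ {n} (f : Fin n → ℤ) → (∀ j → f j ≡ 0ℤ) → sum f ≡ 0ℤ
sum-zero {n} f f≡0 = trans (sum-cong-≗ f≡0) (sum-replicate-zero n)

NontrivialKernel : ∀ {b a} → (Fin b → Fin a → ℤ) → Set
NontrivialKernel {b} {a} M = Σ (Fin a → ℤ) λ v →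
  (∃ λ j → v j ≢ 0ℤ) × (∀ i → sum (λ j → M i j ℤ.* v j) ≡ 0ℤ)

-- Fraction-free Gaussian elimination on the first row.
kernel : ∀ b {a} (M : Fin b → Fin a → ℤ) → b < a → NontrivialKernel M
kernel zero    {suc a} M _ = (λ _ → 1ℤ) , (zero , λ ()) , λ ()
kernel (suc b) {suc a} M (s≤s b<a) with any? (λ j → ¬? (M zero j ℤ.≟ 0ℤ))
... | no  row≡0 =
  let v , v≢0 , Mv = kernel b (λ i → M (suc i)) (ℕ.m<n⇒m<1+n b<a) in
  v , v≢0 , λ
    { zero    → sum-zero _ (λ j → cong (ℤ._* v j)
                  (decidable-stable (M zero j ℤ.≟ 0ℤ) (λ ≢0 → row≡0 (j , ≢0))))
    ; (suc i) → Mv i }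
... | yes (j , p≢0) = v , (punchIn j k , v≢0) , rows
  where
  open ≡-Reasoning
  p : ℤ
  p = M zero j
  M′ : Fin b → Fin a → ℤ
  M′ i k = p ℤ.* M (suc i) (punchIn j k) ℤ.- M (suc i) j ℤ.* M zero (punchIn j k)
  solution : NontrivialKernel M′
  solution = kernel b M′ b<a
  u : Fin a → ℤ
  u = proj₁ solution
  k : Fin a
  k = proj₁ (proj₁ (proj₂ solution))
  -- The pivot variable solves the first row; the other variables are scaled by `p` so that its
  -- value is an integer.
  pivot : ℤ
  pivot = ℤ.- sum (λ k → M zero (punchIn j k) ℤ.* u k)
  v : Fin (suc a) → ℤ
  v = insertAt (λ k → p ℤ.* u k) j pivot
  v-punchIn : ∀ k → v (punchIn j k) ≡ p ℤ.* u k
  v-punchIn = insertAt-punchIn _ j pivot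
  v≢0 : v (punchIn j k) ≢ 0ℤ
  v≢0 eq with ℤ.i*j≡0⇒i≡0∨j≡0 p (trans (sym (v-punchIn k)) eq)
  ... | inj₁ p≡0 = p≢0 p≡0
  ... | inj₂ u≡0 = proj₂ (proj₁ (proj₂ solution)) u≡0
  -- Elimination of the pivot column: for the first row the new coefficients are zero, for the
  -- others they form a row of `M′`.
  expand : ∀ r → sum (λ i → r i ℤ.* v i) ≡ sum (λ k → (p ℤ.* r (punchIn j k) ℤ.- r j ℤ.* M zero (punchIn j k)) ℤ.* u k)
  expand r = begin
    sum (λ i → r i ℤ.* v i)
      ≡⟨ sum-remove {i = j} (λ i → r i ℤ.* v i) ⟩
    r j ℤ.* v j ℤ.+ sum (λ k → r (punchIn j k) ℤ.* v (punchIn j k))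
      ≡⟨ cong₂ ℤ._+_ (trans (cong (r j ℤ.*_) (insertAt-lookup _ j pivot)) (neg-assoc (r j) _))
                     (sum-cong-≗ (λ k → cong (r (punchIn j k) ℤ.*_) (v-punchIn k))) ⟩
    (ℤ.- r j) ℤ.* sum (λ k → M zero (punchIn j k) ℤ.* u k) ℤ.+ sum (λ k → r (punchIn j k) ℤ.* (p ℤ.* u k))
      ≡⟨ cong (ℤ._+ sum (λ k → r (punchIn j k) ℤ.* (p ℤ.* u k))) (*-distribˡ-sum (ℤ.- r j) (λ k → M zero (punchIn j k) ℤ.* u k)) ⟩
    sum (λ k → (ℤ.- r j) ℤ.* (M zero (punchIn j k) ℤ.* u k)) ℤ.+ sum (λ k → r (punchIn j k) ℤ.* (p ℤ.* u k))
      ≡⟨ ∑-distrib-+ (λ k → (ℤ.- r j) ℤ.* (M zero (punchIn j k) ℤ.* u k)) (λ k → r (punchIn j k) ℤ.* (p ℤ.* u k)) ⟨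
    sum (λ k → (ℤ.- r j) ℤ.* (M zero (punchIn j k) ℤ.* u k) ℤ.+ r (punchIn j k) ℤ.* (p ℤ.* u k))
      ≡⟨ sum-cong-≗ (λ k → regroup (r j) (M zero (punchIn j k)) (u k) (r (punchIn j k)) p) ⟩
    sum (λ k → (p ℤ.* r (punchIn j k) ℤ.- r j ℤ.* M zero (punchIn j k)) ℤ.* u k) ∎
    where
    neg-assoc : ∀ x y → x ℤ.* (ℤ.- y) ≡ (ℤ.- x) ℤ.* y
    neg-assoc = ℤ-Solver.solve-∀
    regroup : ∀ r m u s p → (ℤ.- r) ℤ.* (m ℤ.* u) ℤ.+ s ℤ.* (p ℤ.* u) ≡ (p ℤ.* s ℤ.- r ℤ.* m) ℤ.* u
    regroup = ℤ-Solver.solve-∀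
  rows : ∀ i → sum (λ l → M i l ℤ.* v l) ≡ 0ℤ
  rows zero    = trans (expand (M zero)) (sum-zero _ (λ k → cancel p (M zero (punchIn j k)) (u k)))
    where
    cancel : ∀ p m u → (p ℤ.* m ℤ.- p ℤ.* m) ℤ.* u ≡ 0ℤ
    cancel = ℤ-Solver.solve-∀
  rows (suc i) = trans (expand (M (suc i))) (proj₂ (proj₂ solution) i)

-- Linear maps on functions of binary words

Word : Set
Word = List Bool

_≟W_ : DecidableEquality Word
_≟W_ = List.≡-dec Bool._≟_

record Linear (T : (Word → ℤ) → Word → ℤ) : Set where
  field
    resp  : ∀ {f g} → f ≗ g → T f ≗ T g
    add   : ∀ f g w → T (λ u → f u ℤ.+ g u) w ≡ T f w ℤ.+ T g w
    scal  : ∀ c f w → T (λ u → c ℤ.* f u) w ≡ c ℤ.* T f w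

  null : ∀ {f} → (∀ w → f w ≡ 0ℤ) → ∀ w → T f w ≡ 0ℤ
  null {f} f≡0 w = trans (resp {g = λ u → 0ℤ ℤ.* f u} f≡0 w) (scal 0ℤ f w)

δ : Word → Word → ℤ
δ x w = if does (x ≟W w) then 1ℤ else 0ℤ

δ-refl : ∀ x → δ x x ≡ 1ℤ
δ-refl x rewrite dec-true (x ≟W x) refl = refl

δ-≢ : ∀ {x w} → x ≢ w → δ x w ≡ 0ℤ
δ-≢ {x} {w} x≢w rewrite dec-false (x ≟W w) x≢w = refl

combination : (xs : List Word) → (Fin (length xs) → ℤ) → Word → ℤ
combination []       v w = 0ℤ
combination (x ∷ xs) v w = v zero ℤ.* δ x w ℤ.+ combination xs (λ j → v (suc j)) w

combination-∉ : ∀ {xs} v {w} → All (_≢ w) xs → combination xs v w ≡ 0ℤ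
combination-∉         v []       = refl
combination-∉ {x ∷ _} v (p ∷ ps) =
  trans (cong₂ ℤ._+_ (cong (v zero ℤ.*_) (δ-≢ p)) (combination-∉ (λ j → v (suc j)) ps))
        (trans (ℤ.+-identityʳ _) (ℤ.*-zeroʳ (v zero)))

combination-lookup : ∀ {xs} → Unique xs → ∀ v j → combination xs v (lookup xs j) ≡ v j
combination-lookup {x ∷ xs} (x∉ ∷ _) v zero =
  trans (cong₂ ℤ._+_ (cong (v zero ℤ.*_) (δ-refl x))
          (combination-∉ (λ j → v (suc j)) (All.map (λ x≢y y≡x → x≢y (sym y≡x)) x∉)))
        (trans (ℤ.+-identityʳ _) (ℤ.*-identityʳ (v zero)))
combination-lookup {x ∷ xs} (x∉ ∷ uniq) v (suc j) =
  trans (cong₂ ℤ._+_ (trans (cong (v zero ℤ.*_) (δ-≢ (All.lookup x∉ (∈-lookup j)))) (ℤ.*-zeroʳ (v zero)))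
          (combination-lookup uniq (λ j → v (suc j)) j))
        (ℤ.+-identityˡ _)

linear-combination : ∀ {T} → Linear T → ∀ xs v w →
  T (combination xs v) w ≡ sum (λ j → T (δ (lookup xs j)) w ℤ.* v j)
linear-combination lin []       v w = null (λ _ → refl) w
  where open Linear lin
linear-combination {T} lin (x ∷ xs) v w =
  trans (add _ _ w) (cong₂ ℤ._+_ (trans (scal (v zero) (δ x) w) (ℤ.*-comm (v zero) (T (δ x) w)))
                                 (linear-combination lin xs (λ j → v (suc j)) w))
  where open Linear lin

Supported : List Word → (Word → ℤ) → Set
Supported xs f = ∀ w → ¬ w ∈ xs → f w ≡ 0ℤ

-- If ys were shorter than xs, the matrix of `T` would have more columns than rows; a kernel vector
-- then gives a nonzero function supported on xs that `T` kills, against injectivity.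
dimension-≤ : ∀ {T} → Linear T → ∀ {xs ys} → Unique xs →
  (∀ f → Supported xs f → Supported ys (T f)) →
  (∀ f → Supported xs f → (∀ w → T f w ≡ 0ℤ) → ∀ w → f w ≡ 0ℤ) →
  length xs ≤ length ys
dimension-≤ {T} lin {xs} {ys} uniq maps injective with length xs ℕ.≤? length ys
... | yes le = le
... | no ¬le = contradiction (trans (sym (combination-lookup uniq v j)) (injective f f-supported Tf≡0 (lookup xs j))) v≢0
  where
  open import Data.List.Membership.DecPropositional _≟W_ using (_∈?_)
  matrix : Fin (length ys) → Fin (length xs) → ℤ
  matrix i j = T (δ (lookup xs j)) (lookup ys i)
  solution : NontrivialKernel matrix
  solution = kernel (length ys) matrix (ℕ.≰⇒> ¬le)
  v : Fin (length xs) → ℤ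
  v = proj₁ solution
  j : Fin (length xs)
  j = proj₁ (proj₁ (proj₂ solution))
  v≢0 : v j ≢ 0ℤ
  v≢0 = proj₂ (proj₁ (proj₂ solution))
  f : Word → ℤ
  f = combination xs v
  f-supported : Supported xs f
  f-supported w w∉ = combination-∉ v (All.map (λ w≢x x≡w → w≢x (sym x≡w)) (All.¬Any⇒All¬ xs w∉))
  Tf≡0 : ∀ w → T f w ≡ 0ℤ
  Tf≡0 w with w ∈? ys
  ... | no  w∉ = maps f f-supported w w∉
  ... | yes w∈ = subst (λ u → T f u ≡ 0ℤ) (sym (Any.lookup-index w∈))
                   (trans (linear-combination lin xs v _) (proj₂ (proj₂ solution) (Any.index w∈)))

-- Raising and lowering operators on words

-- hop false moves a letter "true" one place to the right, hop true one place to the left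
-- (acting on functions, so the argument shows the word after the move);
-- the weight c depends on the number of letters behind the two exchanged ones.
hop : Bool → (ℕ → ℤ) → (Word → ℤ) → Bool → Word → ℤ
hop s     c f a     []          = 0ℤ
hop false c f false (true  ∷ w) = c (length w) ℤ.* f (true ∷ false ∷ w)
hop false c f false (false ∷ w) = 0ℤ
hop false c f true  (b ∷ w)     = 0ℤ
hop true  c f true  (false ∷ w) = c (length w) ℤ.* f (false ∷ true ∷ w)
hop true  c f true  (true  ∷ w) = 0ℤ
hop true  c f false (b ∷ w)     = 0ℤ

-- The Leibniz rule on the exterior power: one letter moves at a time. Letters `true` never pass one
-- another, so no signs arise.
hops : Bool → (ℕ → ℤ) → (Word → ℤ) → Word → ℤ
hops s c f []      = 0ℤ
hops s c f (a ∷ w) = hop s c f a w ℤ.+ hops s c (λ u → f (a ∷ u)) w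

hop-cong : ∀ s c {f g} → f ≗ g → ∀ a w → hop s c f a w ≡ hop s c g a w
hop-cong s     c e a     []          = refl
hop-cong false c e false (true  ∷ w) = cong (c (length w) ℤ.*_) (e _)
hop-cong false c e false (false ∷ w) = refl
hop-cong false c e true  (b ∷ w)     = refl
hop-cong true  c e true  (false ∷ w) = cong (c (length w) ℤ.*_) (e _)
hop-cong true  c e true  (true  ∷ w) = refl
hop-cong true  c e false (b ∷ w)     = refl

hop-add : ∀ s c f g a w → hop s c (λ u → f u ℤ.+ g u) a w ≡ hop s c f a w ℤ.+ hop s c g a w
hop-add s     c f g a     []          = refl
hop-add false c f g false (true  ∷ w) = ℤ.*-distribˡ-+ (c (length w)) _ _
hop-add false c f g false (false ∷ w) = refl
hop-add false c f g true  (b ∷ w)     = refl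
hop-add true  c f g true  (false ∷ w) = ℤ.*-distribˡ-+ (c (length w)) _ _
hop-add true  c f g true  (true  ∷ w) = refl
hop-add true  c f g false (b ∷ w)     = refl

*-swap : ∀ x y z → x ℤ.* (y ℤ.* z) ≡ y ℤ.* (x ℤ.* z)
*-swap = ℤ-Solver.solve-∀

hop-length : ∀ s c (d : ℕ → ℤ) f a w → hop s c (λ u → d (length u) ℤ.* f u) a w ≡ d (suc (length w)) ℤ.* hop s c f a w
hop-length s     c d f a     []          = sym (ℤ.*-zeroʳ (d 1))
hop-length false c d f false (true  ∷ w) = *-swap (c (length w)) (d (suc (suc (length w)))) _
hop-length false c d f false (false ∷ w) = sym (ℤ.*-zeroʳ (d (suc (suc (length w)))))
hop-length false c d f true  (b ∷ w)     = sym (ℤ.*-zeroʳ (d (suc (suc (length w)))))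
hop-length true  c d f true  (false ∷ w) = *-swap (c (length w)) (d (suc (suc (length w)))) _
hop-length true  c d f true  (true  ∷ w) = sym (ℤ.*-zeroʳ (d (suc (suc (length w)))))
hop-length true  c d f false (b ∷ w)     = sym (ℤ.*-zeroʳ (d (suc (suc (length w)))))

hops-cong : ∀ s c {f g} → f ≗ g → hops s c f ≗ hops s c g
hops-cong s c e []      = refl
hops-cong s c e (a ∷ w) = cong₂ ℤ._+_ (hop-cong s c e a w) (hops-cong s c (λ u → e (a ∷ u)) w)

hops-add : ∀ s c f g w → hops s c (λ u → f u ℤ.+ g u) w ≡ hops s c f w ℤ.+ hops s c g w
hops-add s c f g []      = refl
hops-add s c f g (a ∷ w) =
  trans (cong₂ ℤ._+_ (hop-add s c f g a w) (hops-add s c (λ u → f (a ∷ u)) (λ u → g (a ∷ u)) w))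
        (interchange (hop s c f a w) (hop s c g a w) _ _)
  where
  interchange : ∀ p q r s → (p ℤ.+ q) ℤ.+ (r ℤ.+ s) ≡ (p ℤ.+ r) ℤ.+ (q ℤ.+ s)
  interchange = ℤ-Solver.solve-∀

-- Exchanges preserve the length, so a factor depending on it passes through. Constant d gives
-- linearity; d = c serves in `hop-commutator`, where the weight of the front pair depends on the
-- length of the tail.
hops-length : ∀ s c (d : ℕ → ℤ) f w → hops s c (λ u → d (length u) ℤ.* f u) w ≡ d (length w) ℤ.* hops s c f w
hops-length s c d f []      = sym (ℤ.*-zeroʳ (d 0))
hops-length s c d f (a ∷ w) =
  trans (cong₂ ℤ._+_ (hop-length s c d f a w) (hops-length s c (λ n → d (suc n)) (λ u → f (a ∷ u)) w))
        (sym (ℤ.*-distribˡ-+ (d (suc (length w))) _ _))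

hops-linear : ∀ s c → Linear (hops s c)
hops-linear s c = record
  { resp = hops-cong s c
  ; add  = hops-add s c
  ; scal = λ d → hops-length s c (λ _ → d) }

X : (Word → ℤ) → Word → ℤ
X = hops false (λ _ → 1ℤ)

X-linear : Linear X
X-linear = hops-linear false (λ _ → 1ℤ)

Y : (ℕ → ℤ) → (Word → ℤ) → Word → ℤ
Y = hops true

value : Bool → ℤ
value true  = 1ℤ
value false = 0ℤ

weight₀ : (ℕ → ℤ) → Bool → Word → ℤ
weight₀ c a []      = 0ℤ
weight₀ c a (b ∷ w) = c (length w) ℤ.* (value b ℤ.- value a)

-- The diagonal of the commutator of `X` and `Y c`: exchanging an adjacent pair and back restores
-- the word, with a sign telling which of the two letters is `true`.
weight : (ℕ → ℤ) → Word → ℤ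
weight c []      = 0ℤ
weight c (a ∷ w) = weight₀ c a w ℤ.+ weight c w

hop-left-false : ∀ c f u → hop true c f false u ≡ 0ℤ
hop-left-false c f []      = refl
hop-left-false c f (b ∷ u) = refl

hop-right-true : ∀ c f u → hop false c f true u ≡ 0ℤ
hop-right-true c f []      = refl
hop-right-true c f (b ∷ u) = refl

-- Hops at different places commute, even when they share a letter.
hop-commutator : ∀ c f a w →
  hop false (λ _ → 1ℤ) (Y c f) a w ℤ.+ X (hop true c f a) w ≡
  (hop true c (X f) a w ℤ.+ Y c (hop false (λ _ → 1ℤ) f a) w) ℤ.+ weight₀ c a w ℤ.* f (a ∷ w)
hop-commutator c f a     []          = refl
hop-commutator c f false (false ∷ w) = begin
  0ℤ ℤ.+ X (hop true c f false) (false ∷ w)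
    ≡⟨ cong (λ z → 0ℤ ℤ.+ z) (Linear.null X-linear (hop-left-false c f) (false ∷ w)) ⟩
  0ℤ
    ≡⟨ simplify (c (length w)) (f (false ∷ false ∷ w)) ⟨
  (0ℤ ℤ.+ (0ℤ ℤ.+ 0ℤ)) ℤ.+ (c (length w) ℤ.* (0ℤ ℤ.- 0ℤ)) ℤ.* f (false ∷ false ∷ w)
    ≡⟨ cong (λ z → (0ℤ ℤ.+ z) ℤ.+ (c (length w) ℤ.* (0ℤ ℤ.- 0ℤ)) ℤ.* f (false ∷ false ∷ w))
         (cong₂ ℤ._+_ (hop-left-false c (hop false (λ _ → 1ℤ) f false) w)
                      (Linear.null (hops-linear true c) (λ _ → refl) w)) ⟨
  _ ∎
  where
  open ≡-Reasoning
  simplify : ∀ c x → (0ℤ ℤ.+ (0ℤ ℤ.+ 0ℤ)) ℤ.+ (c ℤ.* (0ℤ ℤ.- 0ℤ)) ℤ.* x ≡ 0ℤ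
  simplify = ℤ-Solver.solve-∀
hop-commutator c f false (true ∷ w) = begin
  1ℤ ℤ.* (c (length w) ℤ.* f (false ∷ true ∷ w) ℤ.+ (hop true c (λ u → f (true ∷ u)) false w ℤ.+ Yf)) ℤ.+ X (hop true c f false) (true ∷ w)
    ≡⟨ cong₂ (λ y z → 1ℤ ℤ.* (c (length w) ℤ.* f (false ∷ true ∷ w) ℤ.+ (y ℤ.+ Yf)) ℤ.+ z)
         (hop-left-false c (λ u → f (true ∷ u)) w) (Linear.null X-linear (hop-left-false c f) (true ∷ w)) ⟩
  1ℤ ℤ.* (c (length w) ℤ.* f (false ∷ true ∷ w) ℤ.+ (0ℤ ℤ.+ Yf)) ℤ.+ 0ℤ
    ≡⟨ simplify (c (length w)) (f (false ∷ true ∷ w)) Yf ⟩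
  (0ℤ ℤ.+ (0ℤ ℤ.+ 1ℤ ℤ.* Yf)) ℤ.+ (c (length w) ℤ.* (1ℤ ℤ.- 0ℤ)) ℤ.* f (false ∷ true ∷ w)
    ≡⟨ cong (λ z → (0ℤ ℤ.+ z) ℤ.+ (c (length w) ℤ.* (1ℤ ℤ.- 0ℤ)) ℤ.* f (false ∷ true ∷ w))
         (cong₂ ℤ._+_ (blocked w) (Linear.scal (hops-linear true c) 1ℤ (λ u → f (true ∷ false ∷ u)) w)) ⟨
  _ ∎
  where
  open ≡-Reasoning
  Yf : ℤ
  Yf = Y c (λ u → f (true ∷ false ∷ u)) w
  -- Of two moves sharing the middle letter, one would have to act on a pair of equal letters, where
  -- `hop` vanishes.
  blocked : ∀ w → hop true c (hop false (λ _ → 1ℤ) f false) true w ≡ 0ℤ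
  blocked []          = refl
  blocked (true  ∷ w) = refl
  blocked (false ∷ w) = ℤ.*-zeroʳ (c (length w))
  simplify : ∀ c x y → 1ℤ ℤ.* (c ℤ.* x ℤ.+ (0ℤ ℤ.+ y)) ℤ.+ 0ℤ ≡ (0ℤ ℤ.+ (0ℤ ℤ.+ 1ℤ ℤ.* y)) ℤ.+ (c ℤ.* (1ℤ ℤ.- 0ℤ)) ℤ.* x
  simplify = ℤ-Solver.solve-∀
hop-commutator c f true (true ∷ w) = begin
  0ℤ ℤ.+ X (hop true c f true) (true ∷ w)
    ≡⟨ cong (λ z → 0ℤ ℤ.+ z) (cong₂ ℤ._+_ (hop-right-true (λ _ → 1ℤ) (hop true c f true) w)
                                           (Linear.null X-linear (λ _ → refl) w)) ⟩
  0ℤ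
    ≡⟨ simplify (c (length w)) (f (true ∷ true ∷ w)) ⟨
  (0ℤ ℤ.+ 0ℤ) ℤ.+ (c (length w) ℤ.* (1ℤ ℤ.- 1ℤ)) ℤ.* f (true ∷ true ∷ w)
    ≡⟨ cong (λ z → (0ℤ ℤ.+ z) ℤ.+ (c (length w) ℤ.* (1ℤ ℤ.- 1ℤ)) ℤ.* f (true ∷ true ∷ w))
         (Linear.null (hops-linear true c) (hop-right-true (λ _ → 1ℤ) f) (true ∷ w)) ⟨
  _ ∎
  where
  open ≡-Reasoning
  simplify : ∀ c x → (0ℤ ℤ.+ 0ℤ) ℤ.+ (c ℤ.* (1ℤ ℤ.- 1ℤ)) ℤ.* x ≡ 0ℤ
  simplify = ℤ-Solver.solve-∀
hop-commutator c f true (false ∷ w) = begin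
  0ℤ ℤ.+ (hop false (λ _ → 1ℤ) (hop true c f true) false w ℤ.+ X (λ u → c (length u) ℤ.* f (false ∷ true ∷ u)) w)
    ≡⟨ cong (λ z → 0ℤ ℤ.+ z) (cong₂ ℤ._+_ (blocked w) (hops-length false (λ _ → 1ℤ) c (λ u → f (false ∷ true ∷ u)) w)) ⟩
  0ℤ ℤ.+ (0ℤ ℤ.+ c (length w) ℤ.* Xf)
    ≡⟨ simplify (c (length w)) (f (true ∷ false ∷ w)) Xf ⟩
  (c (length w) ℤ.* (1ℤ ℤ.* f (true ∷ false ∷ w) ℤ.+ (0ℤ ℤ.+ Xf)) ℤ.+ 0ℤ) ℤ.+ (c (length w) ℤ.* (0ℤ ℤ.- 1ℤ)) ℤ.* f (true ∷ false ∷ w)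
    ≡⟨ cong₂ (λ y z → (c (length w) ℤ.* (1ℤ ℤ.* f (true ∷ false ∷ w) ℤ.+ (y ℤ.+ Xf)) ℤ.+ z)
                      ℤ.+ (c (length w) ℤ.* (0ℤ ℤ.- 1ℤ)) ℤ.* f (true ∷ false ∷ w))
         (hop-right-true (λ _ → 1ℤ) (λ u → f (false ∷ u)) w)
         (Linear.null (hops-linear true c) (hop-right-true (λ _ → 1ℤ) f) (false ∷ w)) ⟨
  _ ∎
  where
  open ≡-Reasoning
  Xf : ℤ
  Xf = X (λ u → f (false ∷ true ∷ u)) w
  blocked : ∀ w → hop false (λ _ → 1ℤ) (hop true c f true) false w ≡ 0ℤ
  blocked []          = refl
  blocked (true  ∷ w) = refl
  blocked (false ∷ w) = refl
  simplify : ∀ c x y → 0ℤ ℤ.+ (0ℤ ℤ.+ c ℤ.* y) ≡ (c ℤ.* (1ℤ ℤ.* x ℤ.+ (0ℤ ℤ.+ y)) ℤ.+ 0ℤ) ℤ.+ (c ℤ.* (0ℤ ℤ.- 1ℤ)) ℤ.* x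
  simplify = ℤ-Solver.solve-∀

-- The sl₂ relation. After splitting off the first letter, `hop-commutator` handles the front pair
-- and induction the tail; the off-diagonal terms agree on both sides.
commutator : ∀ c f w → X (Y c f) w ≡ Y c (X f) w ℤ.+ weight c w ℤ.* f w
commutator c f []      = refl
commutator c f (a ∷ w) = begin
  hop false (λ _ → 1ℤ) (Y c f) a w ℤ.+ X (λ u → hop true c f a u ℤ.+ Y c f′ u) w
    ≡⟨ cong (λ z → hop false (λ _ → 1ℤ) (Y c f) a w ℤ.+ z) (hops-add false (λ _ → 1ℤ) (hop true c f a) (Y c f′) w) ⟩
  hop false (λ _ → 1ℤ) (Y c f) a w ℤ.+ (X (hop true c f a) w ℤ.+ X (Y c f′) w)
    ≡⟨ ℤ.+-assoc (hop false (λ _ → 1ℤ) (Y c f) a w) _ _ ⟨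
  (hop false (λ _ → 1ℤ) (Y c f) a w ℤ.+ X (hop true c f a) w) ℤ.+ X (Y c f′) w
    ≡⟨ cong₂ ℤ._+_ (hop-commutator c f a w) (commutator c f′ w) ⟩
  ((A ℤ.+ B) ℤ.+ weight₀ c a w ℤ.* f (a ∷ w)) ℤ.+ (C ℤ.+ weight c w ℤ.* f (a ∷ w))
    ≡⟨ regroup A B C (weight₀ c a w) (weight c w) (f (a ∷ w)) ⟩
  (A ℤ.+ (B ℤ.+ C)) ℤ.+ (weight₀ c a w ℤ.+ weight c w) ℤ.* f (a ∷ w)
    ≡⟨ cong (λ z → (A ℤ.+ z) ℤ.+ (weight₀ c a w ℤ.+ weight c w) ℤ.* f (a ∷ w))
         (hops-add true c (hop false (λ _ → 1ℤ) f a) (X f′) w) ⟨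
  Y c (X f) (a ∷ w) ℤ.+ weight c (a ∷ w) ℤ.* f (a ∷ w) ∎
  where
  open ≡-Reasoning
  f′ : Word → ℤ
  f′ u = f (a ∷ u)
  A B C : ℤ
  A = hop true c (X f) a w
  B = Y c (hop false (λ _ → 1ℤ) f a) w
  C = Y c (X f′) w
  regroup : ∀ a b c g h x → ((a ℤ.+ b) ℤ.+ g ℤ.* x) ℤ.+ (c ℤ.+ h ℤ.* x) ≡ (a ℤ.+ (b ℤ.+ c)) ℤ.+ (g ℤ.+ h) ℤ.* x
  regroup = ℤ-Solver.solve-∀

-- (number of true, number of false, number of pairs with false before true)
Grade : Set
Grade = ℕ × ℕ × ℕ

_≟G_ : DecidableEquality Grade
_≟G_ = Product.≡-dec ℕ._≟_ (Product.≡-dec ℕ._≟_ ℕ._≟_)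

extend : Bool → Grade → Grade
extend true  (k , l , r) = suc k , l , r
extend false (k , l , r) = k , suc l , k + r

grade : Word → Grade
grade []      = 0 , 0 , 0
grade (a ∷ w) = extend a (grade w)

raise : Grade → Grade
raise (k , l , r) = k , l , suc r

extend-raise : ∀ a γ → extend a (raise γ) ≡ raise (extend a γ)
extend-raise true  γ           = refl
extend-raise false (k , l , r) = cong (λ s → k , suc l , s) (ℕ.+-suc k r)

Homogeneous : Grade → (Word → ℤ) → Set
Homogeneous γ f = ∀ w → grade w ≢ γ → f w ≡ 0ℤ

-- Exchanging one adjacent pair changes the number of pairs with `false` before `true` by exactly 1,
-- so `Y` reads f one grade higher; `X-local` is the mirror fact.
Y-local : ∀ c f w → (∀ u → grade u ≡ raise (grade w) → f u ≡ 0ℤ) → Y c f w ≡ 0ℤ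
Y-local c f []      h = refl
Y-local c f (a ∷ w) h = cong₂ ℤ._+_ (head a w h)
  (Y-local c (λ u → f (a ∷ u)) w
    (λ u eq → h (a ∷ u) (trans (cong (extend a) eq) (extend-raise a (grade w)))))
  where
  head : ∀ a w → (∀ u → grade u ≡ raise (grade (a ∷ w)) → f u ≡ 0ℤ) → hop true c f a w ≡ 0ℤ
  head a     []          h = refl
  head true  (true  ∷ w) h = refl
  head true  (false ∷ w) h = trans (cong (c (length w) ℤ.*_) (h _ refl)) (ℤ.*-zeroʳ (c (length w)))
  head false (b ∷ w)     h = refl

X-local : ∀ f w → (∀ u → raise (grade u) ≡ grade w → f u ≡ 0ℤ) → X f w ≡ 0ℤ
X-local f []      h = refl
X-local f (a ∷ w) h = cong₂ ℤ._+_ (head a w h)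
  (X-local (λ u → f (a ∷ u)) w
    (λ u eq → h (a ∷ u) (trans (sym (extend-raise a (grade u))) (cong (extend a) eq))))
  where
  head : ∀ a w → (∀ u → raise (grade u) ≡ grade (a ∷ w) → f u ≡ 0ℤ) → hop false (λ _ → 1ℤ) f a w ≡ 0ℤ
  head a     []          h = refl
  head false (true  ∷ w) h = cong (1ℤ ℤ.*_) (h _ refl)
  head false (false ∷ w) h = refl
  head true  (b ∷ w)     h = refl

X-homogeneous : ∀ {γ f} → Homogeneous γ f → Homogeneous (raise γ) (X f)
X-homogeneous {f = f} hom w w≢ = X-local f w (λ u eq → hom u (λ u≡ → w≢ (trans (sym eq) (cong raise u≡))))

raise-injective : ∀ {γ γ′} → raise γ ≡ raise γ′ → γ ≡ γ′
raise-injective refl = refl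

Y-homogeneous : ∀ c {γ f} → Homogeneous (raise γ) f → Homogeneous γ (Y c f)
Y-homogeneous c {f = f} hom w w≢ =
  Y-local c f w (λ u eq → hom u (λ u≡ → w≢ (raise-injective (trans (sym eq) u≡))))

Y-lowest : ∀ c {k l f} → Homogeneous (k , l , 0) f → ∀ w → Y c f w ≡ 0ℤ
Y-lowest c {f = f} hom w = Y-local c f w (λ u eq → hom u (λ u≡ → raised≢0 (trans (sym eq) u≡)))
  where
  raised≢0 : ∀ {γ k l} → raise γ ≢ (k , l , 0)
  raised≢0 ()

-- Matrix entries of the lowering operator of sl₂ on its N-dimensional irreducible representation,
-- when the raising operator has entries 1.
coefficient : ℕ → ℕ → ℤ
coefficient N m = (1ℤ ℤ.+ + m) ℤ.* (+ N ℤ.- (1ℤ ℤ.+ + m))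

gradeWeight : ℤ → ℤ → ℤ → ℤ → ℤ
gradeWeight N k l r = k ℤ.* (N ℤ.- k ℤ.- + 2 ℤ.* l) ℤ.+ + 2 ℤ.* r

weightOf : ℕ → Grade → ℤ
weightOf N (k , l , r) = gradeWeight (+ N) (+ k) (+ l) (+ r)

-- Boundary term of the summation by parts in `weight-front`; on words of length N it vanishes,
-- because the second factor of `coefficient N` is then 0.
front : ℕ → Word → ℤ
front N []      = 0ℤ
front N (a ∷ w) = value a ℤ.* coefficient N (length w)

length-grade : ∀ w → length w ≡ proj₁ (grade w) + proj₁ (proj₂ (grade w))
length-grade []          = refl
length-grade (true  ∷ w) = cong suc (length-grade w)
length-grade (false ∷ w) = trans (cong suc (length-grade w)) (sym (ℕ.+-suc _ _))

-- Summation by parts: a letter `true` with m letters behind it contributes c(m) - c(m-1) = N - 1 -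
-- 2m, and these m add up to k(k-1)/2 + kl - r. The front letter has no predecessor and lacks its
-- term c(m).
weight-front : ∀ N w → weight (coefficient N) w ≡ weightOf N (grade w) ℤ.- front N w
weight-front N []              = refl
weight-front N (true ∷ [])     = lemma (+ N)
  where
  lemma : ∀ N → 0ℤ ≡ (1ℤ ℤ.* (N ℤ.- 1ℤ ℤ.- + 2 ℤ.* 0ℤ) ℤ.+ + 2 ℤ.* 0ℤ) ℤ.- 1ℤ ℤ.* ((1ℤ ℤ.+ 0ℤ) ℤ.* (N ℤ.- (1ℤ ℤ.+ 0ℤ)))
  lemma = ℤ-Solver.solve-∀
weight-front N (false ∷ [])    = lemma (+ N)
  where
  lemma : ∀ N → 0ℤ ≡ (0ℤ ℤ.* (N ℤ.- 0ℤ ℤ.- + 2 ℤ.* 1ℤ) ℤ.+ + 2 ℤ.* 0ℤ) ℤ.- 0ℤ ℤ.* ((1ℤ ℤ.+ 0ℤ) ℤ.* (N ℤ.- (1ℤ ℤ.+ 0ℤ)))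
  lemma = ℤ-Solver.solve-∀
weight-front N (a ∷ w@(b ∷ v)) = trans (cong (λ z → weight₀ (coefficient N) a w ℤ.+ z) (weight-front N w))
  (step a (grade w) (length v) (value b) (length-grade w))
  where
  step-true : ∀ N k l r b → let m = k ℤ.+ l ℤ.- 1ℤ in
    ((1ℤ ℤ.+ m) ℤ.* (N ℤ.- (1ℤ ℤ.+ m))) ℤ.* (b ℤ.- 1ℤ)
      ℤ.+ ((k ℤ.* (N ℤ.- k ℤ.- + 2 ℤ.* l) ℤ.+ + 2 ℤ.* r) ℤ.- b ℤ.* ((1ℤ ℤ.+ m) ℤ.* (N ℤ.- (1ℤ ℤ.+ m))))
    ≡ ((1ℤ ℤ.+ k) ℤ.* (N ℤ.- (1ℤ ℤ.+ k) ℤ.- + 2 ℤ.* l) ℤ.+ + 2 ℤ.* r)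
      ℤ.- 1ℤ ℤ.* ((1ℤ ℤ.+ (1ℤ ℤ.+ m)) ℤ.* (N ℤ.- (1ℤ ℤ.+ (1ℤ ℤ.+ m))))
  step-true = ℤ-Solver.solve-∀
  step-false : ∀ N k l r b m x →
    ((1ℤ ℤ.+ m) ℤ.* (N ℤ.- (1ℤ ℤ.+ m))) ℤ.* (b ℤ.- 0ℤ)
      ℤ.+ ((k ℤ.* (N ℤ.- k ℤ.- + 2 ℤ.* l) ℤ.+ + 2 ℤ.* r) ℤ.- b ℤ.* ((1ℤ ℤ.+ m) ℤ.* (N ℤ.- (1ℤ ℤ.+ m))))
    ≡ (k ℤ.* (N ℤ.- k ℤ.- + 2 ℤ.* (1ℤ ℤ.+ l)) ℤ.+ + 2 ℤ.* (k ℤ.+ r)) ℤ.- 0ℤ ℤ.* x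
  step-false = ℤ-Solver.solve-∀
  step : ∀ a γ m β → suc m ≡ proj₁ γ + proj₁ (proj₂ γ) →
    coefficient N m ℤ.* (β ℤ.- value a) ℤ.+ (weightOf N γ ℤ.- β ℤ.* coefficient N m)
    ≡ weightOf N (extend a γ) ℤ.- value a ℤ.* coefficient N (suc m)
  step false (k , l , r) m β _  = step-false (+ N) (+ k) (+ l) (+ r) β (+ m) (coefficient N (suc m))
  step true  (k , l , r) m β eq =
    -- m is expressed as k + l - 1, which turns the claim into a polynomial identity.
    subst (λ μ → ((1ℤ ℤ.+ μ) ℤ.* (+ N ℤ.- (1ℤ ℤ.+ μ))) ℤ.* (β ℤ.- 1ℤ)
      ℤ.+ (weightOf N (k , l , r) ℤ.- β ℤ.* ((1ℤ ℤ.+ μ) ℤ.* (+ N ℤ.- (1ℤ ℤ.+ μ))))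
      ≡ weightOf N (suc k , l , r) ℤ.- 1ℤ ℤ.* ((1ℤ ℤ.+ (1ℤ ℤ.+ μ)) ℤ.* (+ N ℤ.- (1ℤ ℤ.+ (1ℤ ℤ.+ μ)))))
      (cong (ℤ._- 1ℤ) (cong +_ (sym eq))) (step-true (+ N) (+ k) (+ l) (+ r) β)

-- With N = k + l the boundary term vanishes. The resulting weight is negative exactly below the
-- middle degree kl/2.
weight-grade : ∀ {k l r} w → grade w ≡ (k , l , r) →
  weight (coefficient (k + l)) w ≡ + 2 ℤ.* + r ℤ.- + k ℤ.* + l
weight-grade {k} {l} {r} w eq = begin
  weight (coefficient (k + l)) w                       ≡⟨ weight-front (k + l) w ⟩
  weightOf (k + l) (grade w) ℤ.- front (k + l) w       ≡⟨ cong₂ (λ γ z → weightOf (k + l) γ ℤ.- z) eq (front≡0 w (trans (length-grade w) (cong (λ γ → proj₁ γ + proj₁ (proj₂ γ)) eq))) ⟩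
  weightOf (k + l) (k , l , r) ℤ.- 0ℤ                  ≡⟨ simplify (+ k) (+ l) (+ r) ⟩
  + 2 ℤ.* + r ℤ.- + k ℤ.* + l                          ∎
  where
  open ≡-Reasoning
  simplify : ∀ k l r → (k ℤ.* (k ℤ.+ l ℤ.- k ℤ.- + 2 ℤ.* l) ℤ.+ + 2 ℤ.* r) ℤ.- 0ℤ ≡ + 2 ℤ.* r ℤ.- k ℤ.* l
  simplify = ℤ-Solver.solve-∀
  front≡0 : ∀ w → length w ≡ k + l → front (k + l) w ≡ 0ℤ
  front≡0 []      _  = refl
  front≡0 (a ∷ w) eq rewrite sym eq = vanish (value a) (+ length w)
    where
    vanish : ∀ a m → a ℤ.* ((1ℤ ℤ.+ m) ℤ.* ((1ℤ ℤ.+ m) ℤ.- (1ℤ ℤ.+ m))) ≡ 0ℤ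
    vanish = ℤ-Solver.solve-∀

-- If Y X f = -a f, then f₁ = Y f satisfies X f₁ = -a′ f with a′ > 0, hence Y X f₁ = -a′ f₁:
-- the hypothesis is inherited one grade lower, and f₁ = 0 forces f = 0.
low-grade-injective : ∀ k l r a f → 2 * r < k * l → Homogeneous (k , l , r) f →
  (∀ w → Y (coefficient (k + l)) (X f) w ≡ ℤ.- + a ℤ.* f w) → ∀ w → f w ≡ 0ℤ
low-grade-injective k l r a f 2r<kl hom YXf w = conclusion
  where
  open ≡-Reasoning
  c : ℕ → ℤ
  c = coefficient (k + l)
  a′ : ℕ
  a′ = a + (k * l ∸ 2 * r)
  gap : + (k * l ∸ 2 * r) ≡ + k ℤ.* + l ℤ.- + 2 ℤ.* + r
  gap = begin
    + (k * l ∸ 2 * r)               ≡⟨ ℤ.⊖-≥ (ℕ.<⇒≤ 2r<kl) ⟨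
    k * l ℤ.⊖ 2 * r                 ≡⟨ ℤ.m-n≡m⊖n (k * l) (2 * r) ⟨
    + (k * l) ℤ.- + (2 * r)         ≡⟨ cong₂ ℤ._-_ (ℤ.pos-* k l) (ℤ.pos-* 2 r) ⟩
    + k ℤ.* + l ℤ.- + 2 ℤ.* + r     ∎
  weight-f : ∀ w → weight c w ℤ.* f w ≡ (+ 2 ℤ.* + r ℤ.- + k ℤ.* + l) ℤ.* f w
  weight-f w with grade w ≟G (k , l , r)
  ... | yes eq = cong (ℤ._* f w) (weight-grade w eq)
  ... | no  w≢ rewrite hom w w≢ = trans (ℤ.*-zeroʳ (weight c w)) (sym (ℤ.*-zeroʳ (+ 2 ℤ.* + r ℤ.- + k ℤ.* + l)))
  XYf : ∀ w → X (Y c f) w ≡ ℤ.- + a′ ℤ.* f w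
  XYf w = begin
    X (Y c f) w                                           ≡⟨ commutator c f w ⟩
    Y c (X f) w ℤ.+ weight c w ℤ.* f w                    ≡⟨ cong₂ ℤ._+_ (YXf w) (weight-f w) ⟩
    ℤ.- + a ℤ.* f w ℤ.+ (+ 2 ℤ.* + r ℤ.- + k ℤ.* + l) ℤ.* f w
      ≡⟨ collect (+ a) (+ k ℤ.* + l) (+ 2 ℤ.* + r) (f w) ⟩
    ℤ.- (+ a ℤ.+ (+ k ℤ.* + l ℤ.- + 2 ℤ.* + r)) ℤ.* f w   ≡⟨ cong (λ z → ℤ.- (+ a ℤ.+ z) ℤ.* f w) gap ⟨
    ℤ.- + a′ ℤ.* f w                                      ∎
    where
    collect : ∀ a u v x → ℤ.- a ℤ.* x ℤ.+ (v ℤ.- u) ℤ.* x ≡ ℤ.- (a ℤ.+ (u ℤ.- v)) ℤ.* x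
    collect = ℤ-Solver.solve-∀
  Yf≡0 : ∀ r → Homogeneous (k , l , r) f → 2 * r < k * l → ∀ w → Y c f w ≡ 0ℤ
  -- No grade lies below 0, so the recursion on r ends here.
  Yf≡0 zero    hom _  = Y-lowest c hom
  Yf≡0 (suc r) hom lt = low-grade-injective k l r a′ (Y c f)
    (ℕ.≤-<-trans (ℕ.*-monoʳ-≤ 2 (ℕ.n≤1+n r)) lt) (Y-homogeneous c hom)
    (λ w → trans (hops-cong true c XYf w) (Linear.scal (hops-linear true c) (ℤ.- + a′) f w))
  conclusion : f w ≡ 0ℤ
  conclusion with ℤ.i*j≡0⇒i≡0∨j≡0 (ℤ.- + a′) (trans (sym (XYf w)) (Linear.null X-linear (Yf≡0 r hom 2r<kl) w))
  ... | inj₂ f≡0 = f≡0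
  ... | inj₁ a≡0 = contradiction (ℕ.m+n≡0⇒n≡0 a (ℤ.+-injective (ℤ.neg-injective a≡0))) (ℕ.m>n⇒m∸n≢0 2r<kl)

-- Unimodality of the Gaussian polynomials

-- Counterpart of `shift` for lists of words, so that `words` can follow the recursion of `gauss`.
delay : {A : Set} → ℕ → (ℕ → List A) → ℕ → List A
delay zero    g r       = g r
delay (suc d) g zero    = []
delay (suc d) g (suc r) = delay d g r

delay-+ : {A : Set} → ∀ d (g : ℕ → List A) r → delay d g (d + r) ≡ g r
delay-+ zero    g r = refl
delay-+ (suc d) g r = delay-+ d g r

delay-elim : {A : Set} (P : List A → Set) → P [] → ∀ d {g} r → (∀ s → d + s ≡ r → P (g s)) → P (delay d g r)
delay-elim P p[] zero    r       h = h r refl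
delay-elim P p[] (suc d) zero    h = p[]
delay-elim P p[] (suc d) (suc r) h = delay-elim P p[] d r (λ s eq → h s (cong suc eq))

coeff-delay : {A : Set} → ∀ d {p} {g : ℕ → List A} → (∀ r → coeff p r ≡ + length (g r)) →
  ∀ r → coeff (shift d p) r ≡ + length (delay d g r)
coeff-delay zero    e r       = e r
coeff-delay (suc d) e zero    = refl
coeff-delay (suc d) e (suc r) = coeff-delay d e r

-- Splitting by the first letter reproduces the q-Pascal rule: a leading `false` stands before all
-- suc k letters `true` and adds suc k to the degree.
words : ℕ → ℕ → ℕ → List Word
words zero    zero    zero    = [] ∷ []
words zero    zero    (suc r) = []
words zero    (suc l) r       = map (false ∷_) (words zero l r)
words (suc k) zero    r       = map (true ∷_) (words k zero r)
words (suc k) (suc l) r       =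
  map (true ∷_) (words k (suc l) r) ++ map (false ∷_) (delay (suc k) (words (suc k) l) r)

count : ℕ → ℕ → ℕ → ℕ
count k l r = length (words k l r)

count-zeroˡ : ∀ l r → coeff 1P r ≡ + count zero l r
count-zeroˡ zero    zero    = refl
count-zeroˡ zero    (suc r) = refl
count-zeroˡ (suc l) r       = trans (count-zeroˡ l r) (cong +_ (sym (length-map (false ∷_) (words zero l r))))

count-zeroʳ : ∀ k r → coeff 1P r ≡ + count k zero r
count-zeroʳ zero    r = count-zeroˡ zero r
count-zeroʳ (suc k) r = trans (count-zeroʳ k r) (cong +_ (sym (length-map (true ∷_) (words k zero r))))

coeff-gauss : ∀ k l r → coeff (gauss k l) r ≡ + count k l r
coeff-gauss zero    l       r = count-zeroˡ l r
coeff-gauss (suc k) zero    r = count-zeroʳ (suc k) r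
coeff-gauss (suc k) (suc l) r = begin
  coeff (gauss k (suc l) +P shift (suc k) (gauss (suc k) l)) r
    ≡⟨ coeff-+ (gauss k (suc l)) (shift (suc k) (gauss (suc k) l)) r ⟩
  coeff (gauss k (suc l)) r ℤ.+ coeff (shift (suc k) (gauss (suc k) l)) r
    ≡⟨ cong₂ ℤ._+_ (coeff-gauss k (suc l) r) (coeff-delay (suc k) {g = words (suc k) l} (coeff-gauss (suc k) l) r) ⟩
  + (length (words k (suc l) r) + length (delay (suc k) (words (suc k) l) r))
    ≡⟨ cong +_ (cong₂ _+_ (length-map (true ∷_) (words k (suc l) r)) (length-map (false ∷_) (delay (suc k) (words (suc k) l) r))) ⟨
  + (length (map (true ∷_) (words k (suc l) r)) + length (map (false ∷_) (delay (suc k) (words (suc k) l) r)))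
    ≡⟨ cong +_ (length-++ (map (true ∷_) (words k (suc l) r))) ⟨
  + count (suc k) (suc l) r ∎
  where open ≡-Reasoning

words-grade : ∀ k l r → All (λ w → grade w ≡ (k , l , r)) (words k l r)
words-grade zero    zero    zero    = refl ∷ []
words-grade zero    zero    (suc r) = []
words-grade zero    (suc l) r       = All.map⁺ (All.map (cong (extend false)) (words-grade zero l r))
words-grade (suc k) zero    r       = All.map⁺ (All.map (cong (extend true)) (words-grade k zero r))
words-grade (suc k) (suc l) r       = All.++⁺
  (All.map⁺ (All.map (cong (extend true)) (words-grade k (suc l) r)))
  (All.map⁺ (delay-elim (All (λ w → extend false (grade w) ≡ (suc k , suc l , r))) [] (suc k) r
    (λ s eq → All.map (λ e → trans (cong (extend false) e) (cong (λ t → suc k , suc l , t) eq)) (words-grade (suc k) l s))))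

words-complete : ∀ w → let k , l , r = grade w in w ∈ words k l r
words-complete []         = here refl
words-complete (true ∷ w) with grade w | words-complete w
... | k , zero  , r | w∈ = ∈-map⁺ (true ∷_) w∈
... | k , suc l , r | w∈ = ∈-++⁺ˡ (∈-map⁺ (true ∷_) w∈)
words-complete (false ∷ w) with grade w | words-complete w
... | zero  , l , r | w∈ = ∈-map⁺ (false ∷_) w∈
... | suc k , l , r | w∈ = ∈-++⁺ʳ (map (true ∷_) (words k (suc l) (suc k + r)))
  (∈-map⁺ (false ∷_) (subst (w ∈_) (sym (delay-+ (suc k) (words (suc k) l) r)) w∈))

words-unique : ∀ k l r → Unique (words k l r)
words-unique zero    zero    zero    = [] ∷ []
words-unique zero    zero    (suc r) = []
words-unique zero    (suc l) r       = Unique.map⁺ ∷-injectiveʳ (words-unique zero l r)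
words-unique (suc k) zero    r       = Unique.map⁺ ∷-injectiveʳ (words-unique k zero r)
words-unique (suc k) (suc l) r       = Unique.++⁺
  (Unique.map⁺ ∷-injectiveʳ (words-unique k (suc l) r))
  (Unique.map⁺ ∷-injectiveʳ (delay-elim Unique [] (suc k) r (λ s _ → words-unique (suc k) l s)))
  λ { (x∈ , x∈′) → heads-differ (∈-map⁻ (true ∷_) x∈) (∈-map⁻ (false ∷_) x∈′) }
  where
  heads-differ : ∀ {x : Word} {xs ys : List Word} → (∃ λ u → u ∈ xs × x ≡ true ∷ u) →
    ¬ (∃ λ v → v ∈ ys × x ≡ false ∷ v)
  heads-differ (_ , _ , refl) (_ , _ , ())

supported⇒homogeneous : ∀ {k l r f} → Supported (words k l r) f → Homogeneous (k , l , r) f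
supported⇒homogeneous {k} {l} {r} sup w w≢ = sup w (λ w∈ → w≢ (All.lookup (words-grade k l r) w∈))

homogeneous⇒supported : ∀ {k l r f} → Homogeneous (k , l , r) f → Supported (words k l r) f
homogeneous⇒supported hom w w∉ = hom w (λ { refl → w∉ (words-complete w) })

-- By `words-complete` and `words-unique`, the list `words k l r` indexes a basis of the homogeneous
-- functions of that grade, so `count` is a dimension.
count-≤ : ∀ {T} → Linear T → ∀ k l r s →
  (∀ f → Homogeneous (k , l , r) f → Homogeneous (k , l , s) (T f)) →
  (∀ f → Homogeneous (k , l , r) f → (∀ w → T f w ≡ 0ℤ) → ∀ w → f w ≡ 0ℤ) →
  count k l r ≤ count k l s
count-≤ lin k l r s maps injective = dimension-≤ lin (words-unique k l r)
  (λ f sup → homogeneous⇒supported (maps f (supported⇒homogeneous sup)))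
  (λ f sup → injective f (supported⇒homogeneous sup))

-- `X` is injective below the middle: X f = 0 gives Y X f = 0, the hypothesis of
-- `low-grade-injective` with a = 0.
count-increasing : ∀ k l r → 2 * r < k * l → count k l r ≤ count k l (suc r)
count-increasing k l r 2r<kl = count-≤ X-linear k l r (suc r) (λ f → X-homogeneous)
  (λ f hom Xf≡0 → low-grade-injective k l r 0 f 2r<kl hom
    (λ w → trans (Linear.null (hops-linear true (coefficient (k + l))) Xf≡0 w) (sym (ℤ.*-zeroˡ (f w)))))

snoc : Bool → Grade → Grade
snoc true  (k , l , r) = suc k , l , l + r
snoc false (k , l , r) = k , suc l , r

grade-∷ʳ : ∀ w a → grade (w ∷ʳ a) ≡ snoc a (grade w)
grade-∷ʳ []      true  = refl
grade-∷ʳ []      false = refl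
grade-∷ʳ (b ∷ w) a     = trans (cong (extend b) (grade-∷ʳ w a)) (extend-snoc b a (grade w))
  where
  extend-snoc : ∀ b a γ → extend b (snoc a γ) ≡ snoc a (extend b γ)
  extend-snoc true  true  γ           = refl
  extend-snoc true  false γ           = refl
  extend-snoc false false γ           = refl
  extend-snoc false true  (k , l , r) = cong (λ s → suc k , suc l , s) (lemma k l r)
    where
    lemma : ∀ k l r → suc k + (l + r) ≡ suc l + (k + r)
    lemma = ℕ-Solver.solve-∀

ReversedGrade : Grade → Grade → Set
ReversedGrade (k , l , r) (k′ , l′ , r′) = k′ ≡ k × l′ ≡ l × r + r′ ≡ k * l

-- Reversal exchanges the pairs with `false` before `true` and those with `true` before `false`, and
-- there are kl of both kinds together.
grade-reverse : ∀ w → ReversedGrade (grade w) (grade (reverse w))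
grade-reverse []      = refl , refl , refl
grade-reverse (a ∷ w) rewrite unfold-reverse a w | grade-∷ʳ (reverse w) a =
  step a (grade w) (grade (reverse w)) (grade-reverse w)
  where
  step : ∀ a γ γ′ → ReversedGrade γ γ′ → ReversedGrade (extend a γ) (snoc a γ′)
  step true  (k , l , r) (_ , _ , r′) (refl , refl , eq) =
    refl , refl , trans (shuffle r l r′) (cong (λ t → l + t) eq)
    where
    shuffle : ∀ r l r′ → r + (l + r′) ≡ l + (r + r′)
    shuffle = ℕ-Solver.solve-∀
  step false (k , l , r) (_ , _ , r′) (refl , refl , eq) =
    refl , refl , trans (ℕ.+-assoc k r r′) (trans (cong (λ t → k + t) eq) (sym (ℕ.*-suc k l)))

reverse-linear : Linear (λ f w → f (reverse w))
reverse-linear = record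
  { resp = λ e w → e (reverse w)
  ; add  = λ _ _ _ → refl
  ; scal = λ _ _ _ → refl }

-- Composition with `reverse` takes degree r to degree kl - r and is injective, `reverse` being an
-- involution.
count-symmetric : ∀ k l r s → r + s ≡ k * l → count k l r ≤ count k l s
count-symmetric k l r s r+s≡kl = count-≤ reverse-linear k l r s
  (λ f hom w w≢ → hom (reverse w) (λ rev≡ → w≢ (grade-w w rev≡)))
  (λ f hom f≡0 w → trans (cong f (sym (reverse-involutive w))) (f≡0 (reverse w)))
  where
  grade-w : ∀ w → grade (reverse w) ≡ (k , l , r) → grade w ≡ (k , l , s)
  grade-w w rev≡ with grade w | grade (reverse w) | grade-reverse w
  grade-w w refl | _ , _ , t | _ | refl , refl , eq =
    cong (λ s → k , l , s) (ℕ.+-cancelʳ-≡ r t s (trans eq (trans (sym r+s≡kl) (ℕ.+-comm r s))))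

-- The degrees of a word and its reversal add up to kl, so neither exceeds kl.
count-high : ∀ k l r → k * l < r → count k l r ≡ 0
count-high k l r kl<r with words k l r | words-grade k l r
... | []    | _          = refl
... | w ∷ _ | w-grade ∷ _ with grade w | grade (reverse w) | grade-reverse w
count-high k l r kl<r | _ | refl ∷ _ | _ | _ , _ , t | _ , _ , eq =
  contradiction (subst (r ≤_) eq (ℕ.m≤m+n r t)) (ℕ.<⇒≱ kl<r)

-- Reflect degree suc r to s = kl - suc r in the lower half, apply `count-increasing`, and reflect
-- suc s back to r; beyond degree kl there are no words.
count-decreasing : ∀ k l r → k * l ≤ 2 * r → count k l (suc r) ≤ count k l r
count-decreasing k l r kl≤2r with suc r ℕ.≤? k * l
... | no  ≰  = subst (_≤ count k l r) (sym (count-high k l (suc r) (ℕ.≰⇒> ≰))) z≤n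
... | yes r< = ℕ.≤-trans (count-symmetric k l (suc r) s (ℕ.m+[n∸m]≡n r<))
    (ℕ.≤-trans (count-increasing k l s 2s<kl)
      (count-symmetric k l (suc s) r (trans (cong suc (ℕ.+-comm s r)) (ℕ.m+[n∸m]≡n r<))))
  where
  s : ℕ
  s = k * l ∸ suc r
  2s<kl : 2 * s < k * l
  2s<kl = ℕ.+-cancelʳ-< (2 * suc r) (2 * s) (k * l) (begin-strict
    2 * s + 2 * suc r      ≡⟨ ℕ.*-distribˡ-+ 2 s (suc r) ⟨
    2 * (s + suc r)        ≡⟨ cong (2 *_) (ℕ.m∸n+n≡m r<) ⟩
    2 * (k * l)            ≡⟨ double (k * l) ⟩
    k * l + k * l          ≤⟨ ℕ.+-monoʳ-≤ (k * l) kl≤2r ⟩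
    k * l + 2 * r          <⟨ ℕ.+-monoʳ-< (k * l) (ℕ.*-monoʳ-< 2 (ℕ.n<1+n r)) ⟩
    k * l + 2 * suc r      ∎)
    where
    open ℕ.≤-Reasoning
    double : ∀ x → 2 * x ≡ x + x
    double = ℕ-Solver.solve-∀

-- Non-negativity of the quotients

coeff-≥length : ∀ p i → length p ≤ i → coeff p i ≡ 0ℤ
coeff-≥length []      i       _         = refl
coeff-≥length (a ∷ p) (suc i) (s≤s len) = coeff-≥length p i len

module QuotientNonNegative
  (k l m : ℕ) .{{_ : NonZero m}} (A : Poly) (quotient : E 1 *P gauss k l ≃ E m *P A) where

  D : ℕ → ℤ
  D i = coeff (E 1 *P gauss k l) i

  D-zero : D 0 ≡ + count k l 0
  D-zero = trans (coeff-E*-< 1 (gauss k l) ℕ.≤-refl) (coeff-gauss k l 0)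

  D-suc : ∀ j → D (suc j) ≡ + count k l (suc j) ℤ.- + count k l j
  D-suc j = trans (coeff-E*-+ 1 (gauss k l) j) (cong₂ ℤ._-_ (coeff-gauss k l (suc j)) (coeff-gauss k l j))

  -- `D i` compares the degrees i - 1 and i, so `count-increasing` applies as long as 2 (i - 1) <
  -- kl; hence the bound 2 + kl.
  D-low : ∀ i → 2 * i < 2 + k * l → 0ℤ ℤ.≤ D i
  D-low zero    _   = subst (0ℤ ℤ.≤_) (sym D-zero) (ℤ.+≤+ z≤n)
  D-low (suc j) low = subst (0ℤ ℤ.≤_) (sym (D-suc j))
    (ℤ.i≤j⇒0≤j-i (ℤ.+≤+ (count-increasing k l j
      (ℕ.+-cancelˡ-< 2 (2 * j) (k * l) (subst (_< 2 + k * l) (ℕ.*-suc 2 j) low)))))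

  D-high : ∀ j → k * l ≤ 2 * j → D (suc j) ℤ.≤ 0ℤ
  D-high j high = subst (ℤ._≤ 0ℤ) (sym (D-suc j)) (ℤ.i≤j⇒i-j≤0 (ℤ.+≤+ (count-decreasing k l j high)))

  -- A_(m+i) = D_(m+i) + A_i with both terms non-negative, starting from A_i = D_i for i < m.
  A-low : ∀ i → 2 * i < 2 + k * l → 0ℤ ℤ.≤ coeff A i
  A-low = step-induction m (λ i → 2 * i < 2 + k * l → 0ℤ ℤ.≤ coeff A i)
    (λ {i} i<m low → subst (0ℤ ℤ.≤_) (trans (quotient .at i) (coeff-E*-< m A i<m)) (D-low i low))
    (λ i ih low → subst (0ℤ ℤ.≤_) (sym (recurrence i))
      (ℤ.+-mono-≤ (D-low (m + i) low) (ih (ℕ.≤-<-trans (ℕ.*-monoʳ-≤ 2 (ℕ.m≤n+m i m)) low))))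
    where
    add-sub : ∀ x y → x ≡ (x ℤ.- y) ℤ.+ y
    add-sub = ℤ-Solver.solve-∀
    recurrence : ∀ i → coeff A (m + i) ≡ D (m + i) ℤ.+ coeff A i
    recurrence i = trans (add-sub (coeff A (m + i)) (coeff A i))
      (cong (ℤ._+ coeff A i) (sym (trans (quotient .at (m + i)) (coeff-E*-+ m A i))))

  -- A_i = A_(m+i) - D_(m+i), where D_(m+i) ≤ 0 in the upper half. The number t bounds the distance
  -- to the end of the list, where coefficients are zero; as m ≥ 1, each step lowers it by one.
  A-high : ∀ t i → length A ≤ i + t → 2 + k * l ≤ 2 * i → 0ℤ ℤ.≤ coeff A i
  A-high zero    i len _    =
    ℤ.≤-reflexive (sym (coeff-≥length A i (subst (length A ≤_) (ℕ.+-identityʳ i) len)))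
  A-high (suc t) i len high = subst (0ℤ ℤ.≤_) (sym recurrence)
    (ℤ.i≤j⇒0≤j-i (ℤ.≤-trans D≤0 (A-high t (m + i) len′ high′)))
    where
    1≤m : 1 ≤ m
    1≤m = >-nonZero⁻¹ m
    high′ : 2 + k * l ≤ 2 * (m + i)
    high′ = ℕ.≤-trans high (ℕ.*-monoʳ-≤ 2 (ℕ.m≤n+m i m))
    len′ : length A ≤ m + i + t
    len′ = ℕ.≤-trans len (subst (_≤ m + i + t) (sym (ℕ.+-suc i t)) (ℕ.+-monoˡ-≤ t (ℕ.+-monoˡ-≤ i 1≤m)))
    D≤0 : D (m + i) ℤ.≤ 0ℤ
    D≤0 = subst (λ j → D j ℤ.≤ 0ℤ) pred-eq (D-high (m + i ∸ 1)
      (ℕ.+-cancelˡ-≤ 2 (k * l) (2 * (m + i ∸ 1)) (subst (2 + k * l ≤_) (trans (cong (2 *_) (sym pred-eq)) (ℕ.*-suc 2 (m + i ∸ 1))) high′)))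
      where
      pred-eq : suc (m + i ∸ 1) ≡ m + i
      pred-eq = ℕ.m+[n∸m]≡n (ℕ.≤-trans 1≤m (ℕ.m≤m+n m i))
    sub-sub : ∀ x y → y ≡ x ℤ.- (x ℤ.- y)
    sub-sub = ℤ-Solver.solve-∀
    recurrence : coeff A i ≡ coeff A (m + i) ℤ.- D (m + i)
    recurrence = trans (sub-sub (coeff A (m + i)) (coeff A i))
      (cong (λ z → coeff A (m + i) ℤ.- z) (sym (trans (quotient .at (m + i)) (coeff-E*-+ m A i))))

  nonNegative : ∀ i → 0ℤ ℤ.≤ coeff A i
  nonNegative i with 2 * i <? 2 + k * l
  ... | yes low = A-low i low
  ... | no ¬low = A-high (length A) i (ℕ.m≤n+m (length A) i) (ℕ.≮⇒≥ ¬low)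

ℕPoly-∣∣ : ∀ p → (∀ i → 0ℤ ℤ.≤ coeff p i) → ℕPoly→Poly (map ℤ.∣_∣ p) ≃ p
ℕPoly-∣∣ []      _ = ≃-refl
ℕPoly-∣∣ (a ∷ p) h = ∷-cong (ℤ.0≤i⇒+∣i∣≡i (h 0)) (ℕPoly-∣∣ p (λ i → h (suc i)))

gauss-binomial : ∀ {N} κ λ′ n → κ + λ′ ≡ N → gauss (κ * n) (λ′ * n) *P qBinomDen (N * n) (κ * n) ≃ qPoch (N * n)
gauss-binomial κ λ′ n refl rewrite ℕ.*-distribʳ-+ n κ λ′ | ℕ.m+n∸m≡n (κ * n) (λ′ * n) = gauss-product (κ * n) (λ′ * n)

quotient⇒nonNegPolyQuot : ∀ {N} κ λ′ n m .{{_ : NonZero m}} → κ + λ′ ≡ N → Quotient m (κ * n) (λ′ * n) →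
  NonNegPolyQuot m (N * n) (κ * n)
quotient⇒nonNegPolyQuot {N} κ λ′ n m κ+λ′≡N (A , quotient) =
  map ℤ.∣_∣ A ,
  (*P-congʳ Den (*P-congʳ (E m) (ℕPoly-∣∣ A nonNegative) ⊙ *P-comm A (E m) ⊙ ≃-sym quotient)
   ⊙ *P-assoc (E 1) (gauss (κ * n) (λ′ * n)) Den
   ⊙ *P-congˡ (E 1) (gauss-binomial κ λ′ n κ+λ′≡N)) .at
  where
  Den : Poly
  Den = qBinomDen (N * n) (κ * n)
  open QuotientNonNegative (κ * n) (λ′ * n) m A quotient

nonNegPolyQuot : ∀ F → Admissible F → let open Family F in
  ∀ n → 1 ≤ n → NonNegPolyQuot (M * n ∸ 1) (N * n) (κ * n)
nonNegPolyQuot F adm@(κ+λ′≡N , _ , _ , _ , _ , _ , 2≤M , _) n 1≤n =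
  quotient⇒nonNegPolyQuot κ λ′ n (M * n ∸ 1) {{>-nonZero (ℕ.m<n⇒0<n∸m (ℕ.*-mono-≤ 2≤M 1≤n))}} κ+λ′≡N
    (quotient-exists F adm n 1≤n)
  where open Family F

-- With u (1 - q^a) + v (1 - q^b) = 1 - q and quotients A, B for a, b, the quotient is u B + v A.
quotients⇒polyQuot2 : ∀ {N} κ λ′ n a b → κ + λ′ ≡ N → gcd a b ≡ 1 →
  Quotient a (κ * n) (λ′ * n) → Quotient b (κ * n) (λ′ * n) → PolyQuot2 a b (N * n) (κ * n)
quotients⇒polyQuot2 {N} κ λ′ n a b κ+λ′≡N coprime (A , A-eq) (B , B-eq) with E-bézout a b
... | u , v , bézout =
  u *P B +P v *P A ,
  (*P-congʳ Den (expand u v A B (E a) (E b)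
     ⊙ +P-cong (*P-congˡ (u *P E a) (≃-sym B-eq)) (*P-congˡ (v *P E b) (≃-sym A-eq))
     ⊙ collect (u *P E a) (v *P E b) (E 1 *P Gₙ)
     ⊙ *P-congʳ (E 1 *P Gₙ) (subst (λ g → u *P E a +P v *P E b ≃ E g) coprime bézout)
     ⊙ ≃-sym (*P-assoc (E 1) (E 1) Gₙ))
   ⊙ *P-assoc (E 1 *P E 1) Gₙ Den
   ⊙ *P-congˡ (E 1 *P E 1) (gauss-binomial κ λ′ n κ+λ′≡N)) .at
  where
  Den Gₙ : Poly
  Den = qBinomDen (N * n) (κ * n)
  Gₙ = gauss (κ * n) (λ′ * n)
  expand : ∀ u v A B x y → (u *P B +P v *P A) *P x *P y ≃ u *P x *P (y *P B) +P v *P y *P (x *P A)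
  expand = solve-∀ polyACR
  collect : ∀ x y z → x *P z +P y *P z ≃ (x +P y) *P z
  collect = solve-∀ polyACR

-- The quotients of the theorem

coprime-10n-1-15n-1 : ∀ n → 1 ≤ n → gcd (10 * n ∸ 1) (15 * n ∸ 1) ≡ 1
coprime-10n-1-15n-1 n@(suc _) 1≤n =
  -- 3 (10 n - 1) and 2 (15 n - 1) differ by 1.
  ∣1⇒≡1 (gcd-bound 10 15 3 2 1 1 n refl (s≤s z≤n) (s≤s z≤n) (from-yes (∣ 2 - 3 * 1 ∣ ∣? 15 * (15 * (15 * 1)))))

-- α / β is M / κ in lowest terms. The last three have an exceptional index, with |4 - 3 * 3| = 5,
-- |1 - 2 * 2| = 3 and |1 - 3 * 1| = 2, each equal to e; elsewhere d = 1 and j₀ = 1 is a default.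
-- The last two treat the same binomial for the moduli 10 n - 1 and 15 n - 1.
F₁₂,₃ F₁₂,₄ F₆₀,₆ F₁₂₀,₄₀ F₁₂₀,₄₅ F₃₃₀,₈₈ F₃₀,₅ F′₃₀,₅ : Family
F₁₂,₃ = record { N = 12 ; κ = 3 ; λ′ = 9 ; M = 6 ; e = 2 ; α = 2 ; β = 1 ; j₀ = 1 ; d = 1 }
F₁₂,₄ = record { N = 12 ; κ = 4 ; λ′ = 8 ; M = 6 ; e = 2 ; α = 3 ; β = 2 ; j₀ = 1 ; d = 1 }
F₆₀,₆ = record { N = 60 ; κ = 6 ; λ′ = 54 ; M = 30 ; e = 2 ; α = 5 ; β = 1 ; j₀ = 1 ; d = 1 }
F₁₂₀,₄₀ = record { N = 120 ; κ = 40 ; λ′ = 80 ; M = 30 ; e = 4 ; α = 3 ; β = 4 ; j₀ = 1 ; d = 1 }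
F₁₂₀,₄₅ = record { N = 120 ; κ = 45 ; λ′ = 75 ; M = 30 ; e = 4 ; α = 2 ; β = 3 ; j₀ = 1 ; d = 1 }
F₃₃₀,₈₈ = record { N = 330 ; κ = 88 ; λ′ = 242 ; M = 66 ; e = 5 ; α = 3 ; β = 4 ; j₀ = 3 ; d = 5 }
F₃₀,₅ = record { N = 30 ; κ = 5 ; λ′ = 25 ; M = 10 ; e = 3 ; α = 2 ; β = 1 ; j₀ = 2 ; d = 3 }
F′₃₀,₅ = record { N = 30 ; κ = 5 ; λ′ = 25 ; M = 15 ; e = 2 ; α = 3 ; β = 1 ; j₀ = 1 ; d = 2 }

theorem3p1 : (n : ℕ) → 1 ≤ n →
    (NonNegPolyQuot (6 * n ∸ 1) (12 * n) (3 * n)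
    × NonNegPolyQuot (6 * n ∸ 1) (12 * n) (4 * n)
    × NonNegPolyQuot (30 * n ∸ 1) (60 * n) (6 * n)
    × NonNegPolyQuot (30 * n ∸ 1) (120 * n) (40 * n)
    × NonNegPolyQuot (30 * n ∸ 1) (120 * n) (45 * n)
    × NonNegPolyQuot (66 * n ∸ 1) (330 * n) (88 * n))
    × PolyQuot2 (10 * n ∸ 1) (15 * n ∸ 1) (30 * n) (5 * n)
theorem3p1 n 1≤n =
  ( nonNegPolyQuot F₁₂,₃ (from-yes (admissible? F₁₂,₃)) n 1≤n
  , nonNegPolyQuot F₁₂,₄ (from-yes (admissible? F₁₂,₄)) n 1≤n
  , nonNegPolyQuot F₆₀,₆ (from-yes (admissible? F₆₀,₆)) n 1≤n
  , nonNegPolyQuot F₁₂₀,₄₀ (from-yes (admissible? F₁₂₀,₄₀)) n 1≤n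
  , nonNegPolyQuot F₁₂₀,₄₅ (from-yes (admissible? F₁₂₀,₄₅)) n 1≤n
  , nonNegPolyQuot F₃₃₀,₈₈ (from-yes (admissible? F₃₃₀,₈₈)) n 1≤n )
  , quotients⇒polyQuot2 5 25 n (10 * n ∸ 1) (15 * n ∸ 1) refl (coprime-10n-1-15n-1 n 1≤n)
      (quotient-exists F₃₀,₅ (from-yes (admissible? F₃₀,₅)) n 1≤n)
      (quotient-exists F′₃₀,₅ (from-yes (admissible? F′₃₀,₅)) n 1≤n)
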